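{- For all $n\ge2$, the map $\psi$ restricts to a bijection between the set of 1-terminal top-cycle-free chord diagrams of size $n$ and the set of noncrossing chord diagrams of size $n-1$.
   Context: A chord diagram of size $n$ is a perfect matching of $\{1,\dots,2n\}$; chords are ordered pairs $(a,b)$ with $a<b$, $a$ the source and $b$ the sink. A subset of chords is a subdiagram, viewed as a diagram by order-preserving relabelling of endpoints. For chords $c_1=(a_1,b_1)$, $c_2=(a_2,b_2)$ with $a_1<a_2$, they cross if $a_2<b_1<b_2$, and then $c_2$ is a right neighbor of $c_1$. A diagram is noncrossing if no two chords cross. A chord is terminal if it has no right neighbors. A diagram is 1-terminal if no chord other than the last one, in the order of sources, is terminal. For $m\ge3$ the top cycle diagram of size $m$ is $T_m=\{(2i-1,2i+2):1\le i\le m-1\}\cup\{(2,2m-1)\}$; a diagram is top-cycle-free if no subdiagram of it equals (after relabelling) some $T_m$, $m\ge3$. The map $\psi$ from 1-terminal diagrams of size $n$ to diagrams of size $n-1$ ($n\ge 2$): let $T$ be 1-terminal with chords $c_1<\dots<c_n$ ordered by source. The source-sink group of a chord $c$ consists of the source of $c$ together with the maximal run of consecutive sinks immediately following it (excluding the sink of $c$ itself). Then $\psi(T)$ is obtained from $T$ by (1) moving each source to the end of its source-sink group (all other endpoints keeping their relative order and every source staying paired with its sink), and (2) deleting the terminal chord $c_n$; endpoints are then relabelled order-preservingly. -}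

module Defs where

open import Data.Empty using (⊥-elim)
open import Data.Fin as Fin using (Fin; zero; suc; toℕ; cast)
import Data.Fin.Properties as Finₚ
open import Data.List using (List; []; _∷_; length; lookup; filter; allFin)
open import Data.List.Membership.Propositional using (_∈_)
open import Data.List.Membership.Propositional.Properties
  using (∈-allFin; ∈-filter⁺; ∈-filter⁻; ∈-lookup)
open import Data.List.Membership.Propositional.Properties.WithK using (unique∧set⇒bag)
open import Data.List.Properties using (length-tabulate)
open import Data.List.Relation.Binary.BagAndSetEquality using (∼bag⇒↭)
open import Data.List.Relation.Binary.Permutation.Propositional
  using (_↭_; ↭-refl; ↭-sym; ↭-trans; ↭-prep; ↭-swap)
open import Data.List.Relation.Binary.Permutation.Propositional.Properties
  using (∈-resp-↭; ↭-length)
open import Data.List.Relation.Unary.All as All using ([]; _∷_)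
open import Data.List.Relation.Unary.AllPairs using ([]; _∷_)
open import Data.List.Relation.Unary.Any as Any using (here; there; index)
open import Data.List.Relation.Unary.Any.Properties using (lookup-index)
open import Data.List.Relation.Unary.Unique.Propositional using (Unique)
import Data.List.Relation.Unary.Unique.Propositional.Properties as Unique
open import Data.List.Relation.Binary.Permutation.Setoid.Properties using (Unique-resp-↭)
open import Data.List.Relation.Binary.Permutation.Propositional using (↭⇒↭ₛ)
open import Data.Nat using (ℕ; zero; suc; _+_; _*_; _∸_; _≤_; _<_; z≤n; s≤s)
import Data.Nat.Properties as ℕₚ
open import Data.Product using (Σ; ∃; Σ-syntax; ∃-syntax; _×_; _,_; proj₁; proj₂)
open import Data.Sum using (_⊎_; inj₁; inj₂; swap)
open import Function using (_∘_; mk⇔)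
open import Level using (0ℓ)
open import Relation.Binary.Bundles using (Setoid)
import Relation.Binary.Construct.On as On
open import Relation.Binary.PropositionalEquality
  using (_≡_; _≢_; _≗_; refl; sym; trans; cong; subst; setoid; module ≡-Reasoning)
open import Relation.Nullary using (¬_; Dec; yes; no)
open import Relation.Nullary.Decidable using (¬?; _×-dec_)

-- The endpoint written k (1 ≤ k ≤ 2n) in the text is the element k - 1 of
-- Fin (2 * n); a perfect matching is given by the involution exchanging the
-- two ends of every pair.
Point : ℕ → Set
Point n = Fin (2 * n)

record Diagram (n : ℕ) : Set where
  field
    mate             : Point n → Point n
    mate-involutive  : ∀ p → mate (mate p) ≡ p
    mate-irreflexive : ∀ p → mate p ≢ p

open Diagram public

diagramSetoid : ℕ → Setoid 0ℓ 0ℓ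
diagramSetoid n = record
  { Carrier       = Diagram n
  ; _≈_           = λ D E → mate D ≗ mate E
  ; isEquivalence = record
    { refl  = λ _ → refl
    ; sym   = λ eq p → sym (eq p)
    ; trans = λ eq eq′ p → trans (eq p) (eq′ p)
    }
  }

_≈ᴰ_ : ∀ {n} → Diagram n → Diagram n → Set
_≈ᴰ_ {n} = Setoid._≈_ (diagramSetoid n)

module _ {n : ℕ} (D : Diagram n) where

  IsSource IsSink : Point n → Set
  IsSource p = p Fin.< mate D p
  IsSink   p = mate D p Fin.< p

  record Chord : Set where
    constructor chord
    field
      source      : Point n
      source<sink : IsSource source

    sink : Point n
    sink = mate D source

  open Chord

  RightNeighbor : (c₁ c₂ : Chord) → Set
  RightNeighbor c₁ c₂ =
    source c₁ Fin.< source c₂ × source c₂ Fin.< sink c₁ × sink c₁ Fin.< sink c₂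

  Cross : (c₁ c₂ : Chord) → Set
  Cross c₁ c₂ = RightNeighbor c₁ c₂ ⊎ RightNeighbor c₂ c₁

  Noncrossing : Set
  Noncrossing = ∀ c₁ c₂ → ¬ Cross c₁ c₂

  Terminal : Chord → Set
  Terminal c = ∀ c′ → ¬ RightNeighbor c c′

  IsLast : Chord → Set
  IsLast c = ∀ c′ → source c′ Fin.≤ source c

  OneTerminal : Set
  OneTerminal = ∀ c → ¬ IsLast c → ¬ Terminal c

-- E ⊑ D: some subdiagram of D, relabelled, equals E.  The subdiagram is the
-- set of chords of D whose endpoints are in the image of the embedding, and
-- the embedding is the inverse of its order-preserving relabelling.
record _⊑_ {m n : ℕ} (E : Diagram m) (D : Diagram n) : Set where
  field
    embed            : Point m → Point n
    embed-increasing : ∀ {p q} → p Fin.< q → embed p Fin.< embed q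
    embed-mate       : ∀ p → embed (mate E p) ≡ mate D (embed p)

-- Here endpoints are numbered from 1 to 2m, unlike in Point m.
data TopCycleChord (m : ℕ) : ℕ → ℕ → Set where
  path : ∀ {a b} i → 1 ≤ i → i ≤ m ∸ 1 →
         a ≡ 2 * i ∸ 1 → b ≡ 2 * i + 2 → TopCycleChord m a b
  top  : ∀ {a b} → a ≡ 2 → b ≡ 2 * m ∸ 1 → TopCycleChord m a b

TopCycleJoined : ℕ → ℕ → ℕ → Set
TopCycleJoined m a b = TopCycleChord m a b ⊎ TopCycleChord m b a

private
  double : ∀ i → 2 * suc i ≡ suc (suc (2 * i))
  double i = cong suc (ℕₚ.+-suc i (i + 0))

  odd≢even : ∀ i j → suc (2 * i) ≢ 2 * j
  odd≢even i zero ()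
  odd≢even zero (suc j) eq with trans (ℕₚ.suc-injective eq) (ℕₚ.+-suc j (j + 0))
  ... | ()
  odd≢even (suc i) (suc j) eq = odd≢even i j
    (ℕₚ.suc-injective (ℕₚ.suc-injective
      (trans (cong suc (sym (double i))) (trans eq (double j)))))

  pred-odd : ∀ i → 1 ≤ i → ∃[ j ] i ≡ suc j × 2 * i ∸ 1 ≡ suc (2 * j)
  pred-odd (suc j) _ = j , refl , cong (_∸ 1) (double j)

  odd≢even′ : ∀ i j → 1 ≤ i → 2 * i ∸ 1 ≢ 2 * j
  odd≢even′ i j 1≤i eq with pred-odd i 1≤i
  ... | k , refl , eq′ = odd≢even k j (trans (sym eq′) eq)

  even+2 : ∀ i → 2 * i + 2 ≡ 2 * suc i
  even+2 i = trans (ℕₚ.+-comm (2 * i) 2) (sym (double i))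

  odd-injective : ∀ i j → 1 ≤ i → 1 ≤ j → 2 * i ∸ 1 ≡ 2 * j ∸ 1 → i ≡ j
  odd-injective i j 1≤i 1≤j eq with pred-odd i 1≤i | pred-odd j 1≤j
  ... | k , refl , p | l , refl , q =
    cong suc (ℕₚ.*-cancelˡ-≡ k l 2 (ℕₚ.suc-injective (trans (sym p) (trans eq q))))

  even-injective : ∀ i j → 2 * i + 2 ≡ 2 * j + 2 → i ≡ j
  even-injective i j eq = ℕₚ.*-cancelˡ-≡ i j 2 (ℕₚ.+-cancelʳ-≡ 2 (2 * i) (2 * j) eq)

  ≢pred : ∀ m → 1 ≤ m → ¬ m ≤ m ∸ 1
  ≢pred (suc m) _ = ℕₚ.1+n≰n

module _ {m : ℕ} (3≤m : 3 ≤ m) where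

  private
    1≤m : 1 ≤ m
    1≤m = ℕₚ.≤-trans (s≤s z≤n) 3≤m

    1≢0 : ¬ 1 ≤ 0
    1≢0 ()

    zero-index : ∀ {i} → 1 ≤ i → 2 ≢ 2 * i + 2
    zero-index {i} 1≤i eq =
      1≢0 (subst (1 ≤_) (sym (even-injective 0 i eq)) 1≤i)

  TopCycleJoined-functional : ∀ {a b b′} →
    TopCycleJoined m a b → TopCycleJoined m a b′ → b ≡ b′
  TopCycleJoined-functional (inj₁ (path i p _ refl refl)) (inj₁ (path j q _ e refl)) =
    cong (λ k → 2 * k + 2) (odd-injective i j p q e)
  TopCycleJoined-functional (inj₁ (path i p _ refl _)) (inj₁ (top e _)) =
    ⊥-elim (odd≢even′ i 1 p e)
  TopCycleJoined-functional (inj₁ (path i p _ refl _)) (inj₂ (path j _ _ _ e)) =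
    ⊥-elim (odd≢even′ i (suc j) p (trans e (even+2 j)))
  TopCycleJoined-functional (inj₁ (path i p r refl _)) (inj₂ (top _ e)) =
    ⊥-elim (≢pred m 1≤m (subst (_≤ m ∸ 1) (odd-injective i m p 1≤m e) r))
  TopCycleJoined-functional (inj₁ (top refl _)) (inj₁ (path i p _ e _)) =
    ⊥-elim (odd≢even′ i 1 p (sym e))
  TopCycleJoined-functional (inj₁ (top _ refl)) (inj₁ (top _ refl)) = refl
  TopCycleJoined-functional (inj₁ (top e′ _)) (inj₂ (path i p _ _ e)) =
    ⊥-elim (zero-index p (trans (sym e′) e))
  TopCycleJoined-functional (inj₁ (top refl _)) (inj₂ (top _ e)) =
    ⊥-elim (odd≢even′ m 1 1≤m (sym e))
  TopCycleJoined-functional (inj₂ (path i _ _ _ refl)) (inj₁ (path j q _ e _)) =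
    ⊥-elim (odd≢even′ j (suc i) q (trans (sym e) (even+2 i)))
  TopCycleJoined-functional (inj₂ (path i p _ _ e)) (inj₁ (top e′ _)) =
    ⊥-elim (zero-index p (trans (sym e′) e))
  TopCycleJoined-functional (inj₂ (path i _ _ refl refl)) (inj₂ (path j _ _ refl e)) =
    cong (λ k → 2 * k ∸ 1) (even-injective i j e)
  TopCycleJoined-functional (inj₂ (path i _ _ _ refl)) (inj₂ (top _ e)) =
    ⊥-elim (odd≢even′ m (suc i) 1≤m (trans (sym e) (even+2 i)))
  TopCycleJoined-functional (inj₂ (top _ refl)) (inj₁ (path j q r e _)) =
    ⊥-elim (≢pred m 1≤m (subst (_≤ m ∸ 1) (sym (odd-injective m j 1≤m q e)) r))
  TopCycleJoined-functional (inj₂ (top _ refl)) (inj₁ (top e _)) =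
    ⊥-elim (odd≢even′ m 1 1≤m e)
  TopCycleJoined-functional (inj₂ (top _ refl)) (inj₂ (path i _ _ _ e)) =
    ⊥-elim (odd≢even′ m (suc i) 1≤m (trans e (even+2 i)))
  TopCycleJoined-functional (inj₂ (top refl _)) (inj₂ (top refl _)) = refl

  TopCycleJoined-irreflexive : ∀ {a} → ¬ TopCycleJoined m a a
  TopCycleJoined-irreflexive {a} = λ where
      (inj₁ c) → irrefl c
      (inj₂ c) → irrefl c
    where
    irrefl : ¬ TopCycleChord m a a
    irrefl (path i p _ refl e) = odd≢even′ i (suc i) p (trans e (even+2 i))
    irrefl (top refl e)        = odd≢even′ m 1 1≤m (sym e)

  private
    data Parity : ℕ → Set where
      even : ∀ i → Parity (2 * suc i)
      odd  : ∀ i → Parity (2 * suc i ∸ 1)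

    parity : ∀ a → Parity (suc a)
    parity zero = odd 0
    parity (suc a) with suc a | parity a
    ... | _ | even i = subst Parity (cong (_∸ 1) (double (suc i))) (odd (suc i))
    ... | _ | odd  i = even i

    odd-bound : ∀ i → 2 * suc i ∸ 1 ≤ 2 * m → suc i ≤ m
    odd-bound i le = ℕₚ.≮⇒≥ λ m<1+i → ℕₚ.<⇒≱
      (subst (2 * m <_) (sym (cong (_∸ 1) (double i)))
        (s≤s (ℕₚ.*-monoʳ-≤ 2 (ℕₚ.≤-pred m<1+i)))) le

    Partner : ℕ → Set
    Partner a = Σ[ b ∈ ℕ ] 1 ≤ b × b ≤ 2 * m × TopCycleJoined m a b

    m≤2m∸1 : m ≤ 2 * m ∸ 1
    m≤2m∸1 with pred-odd m 1≤m
    ... | k , refl , eq = subst (suc k ≤_) (sym eq) (s≤s (ℕₚ.m≤m+n k (k + 0)))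

    partner : ∀ a → Parity a → a ≤ 2 * m → Partner a
    partner _ (even zero) le =
      2 * m ∸ 1 , ℕₚ.≤-trans 1≤m m≤2m∸1 , ℕₚ.m∸n≤m (2 * m) 1 , inj₁ (top refl refl)
    partner _ (even (suc i)) le =
        2 * suc i ∸ 1
      , subst (1 ≤_) (sym (cong (_∸ 1) (double i))) (s≤s z≤n)
      , ℕₚ.≤-trans (ℕₚ.m∸n≤m (2 * suc i) 1)
          (ℕₚ.*-monoʳ-≤ 2 (ℕₚ.≤-trans (ℕₚ.n≤1+n _) 2+i≤m))
      , inj₂ (path (suc i) (s≤s z≤n) (ℕₚ.∸-monoˡ-≤ 1 2+i≤m) refl (sym (even+2 (suc i))))
      where
      2+i≤m : suc (suc i) ≤ m
      2+i≤m = ℕₚ.*-cancelˡ-≤ 2 le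
    partner _ (odd i) le with ℕₚ.m≤n⇒m<n∨m≡n (odd-bound i le)
    ... | inj₁ 1+i<m =
        2 * suc i + 2
      , s≤s z≤n
      , subst (_≤ 2 * m) (sym (even+2 (suc i))) (ℕₚ.*-monoʳ-≤ 2 1+i<m)
      , inj₁ (path (suc i) (s≤s z≤n) (ℕₚ.∸-monoˡ-≤ 1 1+i<m) refl refl)
    ... | inj₂ 1+i≡m =
        2 , s≤s z≤n , ℕₚ.*-monoʳ-≤ 2 1≤m
      , inj₂ (top refl (cong (λ k → 2 * k ∸ 1) 1+i≡m))

  TopCycleJoined-total : (p : Point m) →
    Σ[ q ∈ Point m ] TopCycleJoined m (suc (toℕ p)) (suc (toℕ q))
  TopCycleJoined-total p with partner _ (parity (toℕ p)) (Finₚ.toℕ<n p)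
  ... | suc b , _ , b<2m , joined = Fin.fromℕ< b<2m ,
    subst (λ k → TopCycleJoined m (suc (toℕ p)) (suc k)) (sym (Finₚ.toℕ-fromℕ< b<2m)) joined

  topCycle : Diagram m
  topCycle = record
    { mate             = λ p → proj₁ (TopCycleJoined-total p)
    ; mate-involutive  = λ p →
        let q , pq = TopCycleJoined-total p
            r , qr = TopCycleJoined-total q
        in Finₚ.toℕ-injective
             (ℕₚ.suc-injective (TopCycleJoined-functional qr (swap pq)))
    ; mate-irreflexive = λ p eq → TopCycleJoined-irreflexive
        (subst (λ q → TopCycleJoined m (suc (toℕ p)) (suc (toℕ q))) eq
          (proj₂ (TopCycleJoined-total p)))
    }

TopCycleFree : ∀ {n} → Diagram n → Set
TopCycleFree D = ∀ m (3≤m : 3 ≤ m) → ¬ topCycle 3≤m ⊑ D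

-- If ws lists, in some order, a set of endpoints of D closed under mate, then
-- relabel reads the matching of D off along ws: its k-th endpoint is the k-th
-- entry of ws.
module _ {n m : ℕ} (D : Diagram n) (ws : List (Point n)) (unique : Unique ws)
         (closed : ∀ {p} → p ∈ ws → mate D p ∈ ws) (len : length ws ≡ 2 * m) where

  at : Point m → Point n
  at k = lookup ws (cast (sym len) k)

  position : ∀ {p} → p ∈ ws → Point m
  position p∈ws = cast len (index p∈ws)

  at-position : ∀ {p} (p∈ws : p ∈ ws) → at (position p∈ws) ≡ p
  at-position p∈ws = trans
    (cong (lookup ws) (Finₚ.cast-involutive (sym len) len (index p∈ws)))
    (sym (lookup-index p∈ws))

  lookup-injective : (xs : List (Point n)) → Unique xs →
                     ∀ i j → lookup xs i ≡ lookup xs j → i ≡ j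
  lookup-injective (x ∷ xs) _          zero    zero    _  = refl
  lookup-injective (x ∷ xs) (x∉ ∷ _)   zero    (suc j) eq =
    ⊥-elim (All.lookup x∉ (∈-lookup j) eq)
  lookup-injective (x ∷ xs) (x∉ ∷ _)   (suc i) zero    eq =
    ⊥-elim (All.lookup x∉ (∈-lookup i) (sym eq))
  lookup-injective (x ∷ xs) (_ ∷ uniq) (suc i) (suc j) eq =
    cong suc (lookup-injective xs uniq i j eq)

  at-injective : ∀ {k l} → at k ≡ at l → k ≡ l
  at-injective {k} {l} eq = begin
    k                                ≡⟨ Finₚ.cast-involutive len (sym len) k ⟨
    cast len (cast (sym len) k)      ≡⟨ cong (cast len) (lookup-injective ws unique _ _ eq) ⟩
    cast len (cast (sym len) l)      ≡⟨ Finₚ.cast-involutive len (sym len) l ⟩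
    l                                ∎
    where open ≡-Reasoning

  at∈ws : ∀ k → at k ∈ ws
  at∈ws k = ∈-lookup (cast (sym len) k)

  relabelled-mate : Point m → Point m
  relabelled-mate k = position (closed (at∈ws k))

  at-relabelled-mate : ∀ k → at (relabelled-mate k) ≡ mate D (at k)
  at-relabelled-mate k = at-position (closed (at∈ws k))

  relabel : Diagram m
  relabel = record
    { mate             = relabelled-mate
    ; mate-involutive  = λ k → at-injective
        (trans (at-relabelled-mate (relabelled-mate k))
          (trans (cong (mate D) (at-relabelled-mate k)) (mate-involutive D (at k))))
    ; mate-irreflexive = λ k eq →
        mate-irreflexive D (at k) (trans (sym (at-relabelled-mate k)) (cong at eq))
    }

module _ {n : ℕ} (D : Diagram n) where

  isSource? : ∀ p → Dec (IsSource D p)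
  isSource? p = p Finₚ.<? mate D p

  -- q can belong to the run of sinks in the source-sink group of the source a.
  OtherSink : (a q : Point n) → Set
  OtherSink a q = IsSink D q × q ≢ mate D a

  otherSink? : ∀ a q → Dec (OtherSink a q)
  otherSink? a q = (mate D q Finₚ.<? q) ×-dec ¬? (q Finₚ.≟ mate D a)

  -- moveSources moves every source to the end of its source-sink group.  In
  -- holdSource a ps the source a has been read but not yet put down: it goes
  -- before the first endpoint of ps that is outside its group.
  mutual
    moveSources : List (Point n) → List (Point n)
    moveSources []       = []
    moveSources (p ∷ ps) with isSource? p
    ... | yes _ = holdSource p ps
    ... | no  _ = p ∷ moveSources ps

    holdSource : Point n → List (Point n) → List (Point n)
    holdSource a []       = a ∷ []
    holdSource a (p ∷ ps) with otherSink? a p | isSource? p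
    ... | yes _ | _     = p ∷ holdSource a ps
    ... | no  _ | yes _ = a ∷ holdSource p ps
    ... | no  _ | no  _ = a ∷ p ∷ moveSources ps

  mutual
    moveSources-↭ : ∀ ps → moveSources ps ↭ ps
    moveSources-↭ []       = ↭-refl
    moveSources-↭ (p ∷ ps) with isSource? p
    ... | yes _ = holdSource-↭ p ps
    ... | no  _ = ↭-prep p (moveSources-↭ ps)

    holdSource-↭ : ∀ a ps → holdSource a ps ↭ a ∷ ps
    holdSource-↭ a []       = ↭-refl
    holdSource-↭ a (p ∷ ps) with otherSink? a p | isSource? p
    ... | yes _ | _     = ↭-trans (↭-prep p (holdSource-↭ a ps)) (↭-swap p a ↭-refl)
    ... | no  _ | yes _ = ↭-prep a (holdSource-↭ p ps)
    ... | no  _ | no  _ = ↭-prep a (↭-prep p (moveSources-↭ ps))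

  rearranged : List (Point n)
  rearranged = moveSources (allFin (2 * n))

  OffChord : Chord D → Point n → Set
  OffChord c p = p ≢ Chord.source c × p ≢ Chord.sink c

  offChord? : ∀ c p → Dec (OffChord c p)
  offChord? c p = ¬? (p Finₚ.≟ Chord.source c) ×-dec ¬? (p Finₚ.≟ Chord.sink c)

  deleteChord : Chord D → List (Point n) → List (Point n)
  deleteChord c = filter (offChord? c)

private
  greatest : ∀ {N} {P : Fin N → Set} → (∀ p → Dec (P p)) → ∃ P →
             Σ[ p ∈ Fin N ] P p × (∀ q → P q → q Fin.≤ p)
  greatest {suc N} P? (p₀ , Pp₀) with Finₚ.any? (P? ∘ suc)
  ... | yes w = let p , Pp , max = greatest (P? ∘ suc) w in
    suc p , Pp , λ { zero _ → z≤n ; (suc q) Pq → s≤s (max q Pq) }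
  greatest {suc N} P? (zero , P0) | no none =
    zero , P0 , λ { zero _ → z≤n ; (suc q) Pq → ⊥-elim (none (q , Pq)) }
  greatest {suc N} P? (suc p₀ , Pp₀) | no none = ⊥-elim (none (p₀ , Pp₀))

module _ {n : ℕ} (D : Diagram (suc n)) where

  private
    someSource : ∃ (IsSource D)
    someSource = zero , ℕₚ.≤∧≢⇒< z≤n
      λ eq → mate-irreflexive D zero (sym (Finₚ.toℕ-injective eq))

  lastChord : Σ[ c ∈ Chord D ] IsLast D c
  lastChord = let p , src , max = greatest (isSource? D) someSource in
    chord p src , λ c → max (Chord.source c) (Chord.source<sink c)

  private
    c : Chord D
    c = proj₁ lastChord

    open Chord c

  ψ-word : List (Point (suc n))
  ψ-word = deleteChord D c (rearranged D)

  private
    all∈ : ∀ p → p ∈ rearranged D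
    all∈ p = ∈-resp-↭ (↭-sym (moveSources-↭ D _)) (∈-allFin p)

    off∈ : ∀ {p} → OffChord D c p → p ∈ ψ-word
    off∈ = ∈-filter⁺ (offChord? D c) (all∈ _)

    ∈off : ∀ {p} → p ∈ ψ-word → OffChord D c p
    ∈off p∈ = proj₂ (∈-filter⁻ (offChord? D c) {xs = rearranged D} p∈)

  ψ-word-unique : Unique ψ-word
  ψ-word-unique = Unique.filter⁺ (offChord? D c)
    (Unique-resp-↭ (setoid _) (↭⇒↭ₛ (↭-sym (moveSources-↭ D _))) (Unique.allFin⁺ _))

  ψ-word-closed : ∀ {p} → p ∈ ψ-word → mate D p ∈ ψ-word
  ψ-word-closed {p} p∈ with ∈off p∈
  ... | p≢a , p≢b = off∈
    ( (λ eq → p≢b (trans (sym (mate-involutive D p)) (cong (mate D) eq)))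
    , (λ eq → p≢a (trans (sym (mate-involutive D p))
                    (trans (cong (mate D) eq) (mate-involutive D source)))) )

  private
    full : source ∷ sink ∷ ψ-word ↭ allFin (2 * suc n)
    full = ∼bag⇒↭ (unique∧set⇒bag
      ( ((λ eq → mate-irreflexive D source (sym eq)) ∷ All.tabulate (λ p∈ eq → proj₁ (∈off p∈) (sym eq)))
      ∷ All.tabulate (λ p∈ eq → proj₂ (∈off p∈) (sym eq))
      ∷ ψ-word-unique)
      (Unique.allFin⁺ _)
      (λ {p} → mk⇔ (λ _ → ∈-allFin p) (λ _ → everything p)))
      where
      everything : ∀ p → p ∈ source ∷ sink ∷ ψ-word
      everything p with p Finₚ.≟ source | p Finₚ.≟ sink
      ... | yes eq | _      = here eq
      ... | no _   | yes eq = there (here eq)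
      ... | no p≢a | no p≢b = there (there (off∈ (p≢a , p≢b)))

  ψ-word-length : length ψ-word ≡ 2 * n
  ψ-word-length = ℕₚ.suc-injective (ℕₚ.suc-injective
    (trans (↭-length full) (trans (length-tabulate {n = 2 * suc n} (λ i → i)) (double n))))

OneTerminalDiagram : ℕ → Set
OneTerminalDiagram n = Σ (Diagram n) OneTerminal

ψ : ∀ {n} → OneTerminalDiagram (suc n) → Diagram n
ψ (T , _) =
  relabel T (ψ-word T) (ψ-word-unique T) (ψ-word-closed T) (ψ-word-length T)

oneTerminalTopCycleFree : ℕ → Setoid 0ℓ 0ℓ
oneTerminalTopCycleFree n = On.setoid (diagramSetoid n) underlying
  where
  underlying : (Σ[ T ∈ OneTerminalDiagram n ] TopCycleFree (proj₁ T)) → Diagram n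
  underlying = proj₁ ∘ proj₁

noncrossing : ℕ → Setoid 0ℓ 0ℓ
noncrossing n = On.setoid (diagramSetoid n) underlying
  where
  underlying : Σ (Diagram n) Noncrossing → Diagram n
  underlying = proj₁

{-# OPTIONS --safe #-}
module Submission where

-- Put the chord deleted by ψ back at the end of the diagram, so that D ⁺ and T
-- have the same size.  For 1-terminal T, a source p comes after a sink q other
-- than its own in the rearranged word exactly when no source r has p < r < q in
-- T; conversely p comes before q in T exactly when no source r has q < r < p in
-- the rearranged word.  So D ⁺ and T determine each other, every D ⁺
-- arises, and ψ is a bijection from 1-terminal diagrams onto all diagrams.
--
-- The crossings x < y < mate x < mate y of T that survive in D are those with a
-- source between y and mate x.  A top cycle contains such a crossing: the first
-- path chord with the top chord.  Conversely, given one, extend the chord x to a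
-- path by repeatedly choosing, among the chords whose source lies between y and
-- the current sink, one with the greatest sink.  As T is 1-terminal the sinks
-- increase until one passes mate y, and greatness makes non-consecutive chords
-- of the path disjoint: with the chord of y, the path is a top cycle.

open import Defs
open import Data.Empty using (⊥-elim)
open import Data.Fin as Fin using (Fin; zero; suc; toℕ)
import Data.Fin.Induction as Finᵢ
import Data.Fin.Properties as Finₚ
open import Data.List using (List; []; _∷_; length; lookup; allFin)
open import Data.List.Membership.Propositional using (_∈_)
open import Data.List.Membership.Propositional.Properties
  using (∈-allFin; ∈-filter⁺; ∈-filter⁻; ∈-lookup)
open import Data.List.Properties using (length-tabulate)
open import Data.List.Relation.Binary.Permutation.Propositional using (↭-sym; ↭⇒↭ₛ)
open import Data.List.Relation.Binary.Permutation.Propositional.Properties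
  using (All-resp-↭; ∈-resp-↭; ↭-length)
open import Data.List.Relation.Binary.Permutation.Setoid.Properties using (Unique-resp-↭)
open import Data.List.Relation.Unary.All as All using (All; []; _∷_)
open import Data.List.Relation.Unary.AllPairs using (AllPairs; []; _∷_)
import Data.List.Relation.Unary.AllPairs.Properties as AllPairs
open import Data.List.Relation.Unary.Any using (here; there)
import Data.List.Relation.Unary.Sorted.TotalOrder.Properties as Sorted
open import Data.List.Relation.Unary.Unique.Propositional using (Unique)
import Data.List.Relation.Unary.Unique.Propositional.Properties as Unique
import Data.List.Sort as Sort
open import Data.Nat using (ℕ; zero; suc; _+_; _*_; _∸_; _≤_; _<_; z≤n; s≤s)
import Data.Nat.Properties as ℕₚ
open import Data.Product using (Σ-syntax; ∃; ∃-syntax; _×_; _,_; proj₁; proj₂)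
open import Data.Sum using (_⊎_; inj₁; inj₂)
open import Function using (_∘_)
open import Function.Bundles using (Bijection)
open import Induction.WellFounded using (Acc; acc)
open import Relation.Binary.Bundles using (DecTotalOrder)
import Relation.Binary.Construct.On as On
open import Relation.Binary.Definitions using (tri<; tri≈; tri>)
open import Relation.Binary.PropositionalEquality
open import Relation.Nullary using (¬_; yes; no)
open import Relation.Nullary.Decidable using (_×-dec_)
open import Relation.Unary using (Decidable)

-- Finite maxima, increasing self-maps, sources and sinks.

maximiser : ∀ {N} (f : Fin N → ℕ) {P : Fin N → Set} → Decidable P → ∃ P →
            ∃[ p ] P p × (∀ q → P q → f q ≤ f p)
maximiser {suc N} f {P} P? (p₀ , Pp₀) with Finₚ.any? (P? ∘ suc) | P? zero
... | no none | no ¬P0 = ⊥-elim (nowhere p₀ Pp₀)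
  where
  nowhere : ∀ p → ¬ P p
  nowhere zero    = ¬P0
  nowhere (suc p) = none ∘ (p ,_)
... | no none | yes P0 = zero , P0 , λ where
  zero    _  → ℕₚ.≤-refl
  (suc q) Pq → ⊥-elim (none (q , Pq))
... | yes some | no ¬P0 with maximiser (f ∘ suc) (P? ∘ suc) some
...   | p , Pp , max = suc p , Pp , λ where
  zero    P0 → ⊥-elim (¬P0 P0)
  (suc q) Pq → max q Pq
maximiser {suc N} f P? (p₀ , Pp₀) | yes some | yes P0
  with maximiser (f ∘ suc) (P? ∘ suc) some
... | p , Pp , max with ℕₚ.≤-total (f zero) (f (suc p))
...   | inj₁ f0≤fp = suc p , Pp , λ where
  zero    _  → f0≤fp
  (suc q) Pq → max q Pq
...   | inj₂ fp≤f0 = zero , P0 , λ where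
  zero    _  → ℕₚ.≤-refl
  (suc q) Pq → ℕₚ.≤-trans (max q Pq) fp≤f0

minimum : ∀ {N} {P : Fin N → Set} → Decidable P → ∃ P →
          ∃[ p ] P p × (∀ q → P q → p Fin.≤ q)
minimum {N} P? some with maximiser (λ p → N ∸ toℕ p) P? some
... | p , Pp , max = p , Pp , λ q Pq → ℕₚ.∸-cancelʳ-≤ (Finₚ.toℕ≤n p) (max q Pq)

-- Strict steps force `h i ≥ i` going up from the least element and `h i ≤ i` going down from the
-- greatest. Both uniqueness statements about `↝` rest on this, applied to a comparison map between
-- two orderings of the same endpoints.
increasing⇒id : ∀ {N} (h : Fin N → Fin N) →
                (∀ {p q} → p Fin.< q → h p Fin.< h q) → ∀ p → h p ≡ p
increasing⇒id {suc N} h increasing p = Finₚ.toℕ-injective (ℕₚ.≤-antisym (below p) (above p))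
  where
  step : ∀ i → toℕ (h (Fin.inject₁ i)) < toℕ (h (suc i))
  step i = increasing (s≤s (ℕₚ.≤-reflexive (Finₚ.toℕ-inject₁ i)))

  above : ∀ p → p Fin.≤ h p
  above = Finᵢ.<-weakInduction _ z≤n λ i i≤hi →
    ℕₚ.≤-<-trans (subst (_≤ toℕ (h (Fin.inject₁ i))) (Finₚ.toℕ-inject₁ i) i≤hi) (step i)

  below : ∀ p → h p Fin.≤ p
  below = Finᵢ.>-weakInduction _ (Finₚ.≤fromℕ _) λ i hi≤i →
    subst (toℕ (h (Fin.inject₁ i)) ≤_) (sym (Finₚ.toℕ-inject₁ i))
      (ℕₚ.≤-pred (ℕₚ.≤-trans (step i) hi≤i))

module _ {n : ℕ} (D : Diagram n) where

  source⊎sink : ∀ p → IsSource D p ⊎ IsSink D p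
  source⊎sink p with Finₚ.<-cmp p (mate D p)
  ... | tri< p<m _ _ = inj₁ p<m
  ... | tri≈ _ p≡m _ = ⊥-elim (mate-irreflexive D p (sym p≡m))
  ... | tri> _ _ m<p = inj₂ m<p

  source≢sink : ∀ {p q} → IsSource D p → IsSink D q → p ≢ q
  source≢sink src snk refl = ℕₚ.<-asym src snk

  mate-sink : ∀ {p} → IsSink D p → IsSource D (mate D p)
  mate-sink {p} = subst (mate D p Fin.<_) (sym (mate-involutive D p))

  mate-source : ∀ {p} → IsSource D p → IsSink D (mate D p)
  mate-source {p} = subst (Fin._< mate D p) (sym (mate-involutive D p))

  mate-injective : ∀ {p q} → mate D p ≡ mate D q → p ≡ q
  mate-injective {p} {q} eq =
    trans (sym (mate-involutive D p)) (trans (cong (mate D) eq) (mate-involutive D q))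

  mate-flip : ∀ {p q} → p ≡ mate D q → mate D p ≡ q
  mate-flip {q = q} eq = trans (cong (mate D) eq) (mate-involutive D q)

<⊎> : ∀ {N} {p q : Fin N} → p ≢ q → p Fin.< q ⊎ q Fin.< p
<⊎> {p = p} {q} p≢q with Finₚ.<-cmp p q
... | tri< p<q _ _ = inj₁ p<q
... | tri≈ _ p≡q _ = ⊥-elim (p≢q p≡q)
... | tri> _ _ q<p = inj₂ q<p

-- Rearranged words

-- Precedence in the word obtained by moving every source of T to the end of
-- its source-sink group.
data Before {n} (T : Diagram n) (p q : Point n) : Set where
  kept   : (IsSource T p → IsSource T q) → p Fin.< q → Before T p q
  own    : IsSource T p → q ≡ mate T p → Before T p q
  parted : ∀ r → IsSource T r → p Fin.< r → r Fin.< q → Before T p q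
  passed : IsSink T p → IsSource T q → q Fin.< p → p ≢ mate T q →
           (∀ r → IsSource T r → q Fin.< r → ¬ r Fin.< p) → Before T p q

module _ {n : ℕ} (T : Diagram n) where

  before-sources : ∀ {p q} → IsSource T p → IsSource T q → Before T p q → p Fin.< q
  before-sources p q (kept _ p<q)         = p<q
  before-sources p q (own _ refl)         = ⊥-elim (ℕₚ.<-asym q (mate-source T p))
  before-sources p q (parted _ _ p<r r<q) = ℕₚ.<-trans p<r r<q
  before-sources p q (passed p′ _ _ _ _)  = ⊥-elim (ℕₚ.<-asym p p′)

  before-sinks : ∀ {p q} → IsSink T p → IsSink T q → Before T p q → p Fin.< q
  before-sinks p q (kept _ p<q)         = p<q
  before-sinks p q (own p′ _)           = ⊥-elim (ℕₚ.<-asym p p′)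
  before-sinks p q (parted _ _ p<r r<q) = ℕₚ.<-trans p<r r<q
  before-sinks p q (passed _ q′ _ _ _)  = ⊥-elim (ℕₚ.<-asym q q′)

  before-source-sink : ∀ {p q} → IsSource T p → IsSink T q → Before T p q →
    q ≡ mate T p ⊎ ∃[ r ] IsSource T r × p Fin.< r × r Fin.< q
  before-source-sink p q (kept f _)             = ⊥-elim (ℕₚ.<-asym q (f p))
  before-source-sink p q (own _ eq)             = inj₁ eq
  before-source-sink p q (parted r src p<r r<q) = inj₂ (r , src , p<r , r<q)
  before-source-sink p q (passed p′ _ _ _ _)    = ⊥-elim (ℕₚ.<-asym p p′)

  before-sink-source : ∀ {p q} → IsSink T p → IsSource T q → Before T p q →
    p ≢ mate T q × (∀ r → IsSource T r → q Fin.< r → ¬ r Fin.< p)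
  before-sink-source {p} {q} p′ q′ before = unmated before , unparted before
    where
    p<q⇒≢ : p Fin.< q → p ≢ mate T q
    p<q⇒≢ p<q eq = ℕₚ.<-asym p<q (subst (q Fin.<_) (sym eq) q′)

    unmated : Before T p q → p ≢ mate T q
    unmated (kept _ p<q)           = p<q⇒≢ p<q
    unmated (own p″ _)             = ⊥-elim (ℕₚ.<-asym p′ p″)
    unmated (parted _ _ p<r r<q)   = p<q⇒≢ (ℕₚ.<-trans p<r r<q)
    unmated (passed _ _ _ ≢mate _) = ≢mate

    unparted : Before T p q → ∀ r → IsSource T r → q Fin.< r → ¬ r Fin.< p
    unparted (kept _ p<q) r _ q<r r<p = ℕₚ.<-asym p<q (ℕₚ.<-trans q<r r<p)
    unparted (own p″ _) = ⊥-elim (ℕₚ.<-asym p′ p″)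
    unparted (parted _ _ p<s s<q) r _ q<r r<p =
      ℕₚ.<-asym (ℕₚ.<-trans p<s s<q) (ℕₚ.<-trans q<r r<p)
    unparted (passed _ _ _ _ none) = none

  -- Between endpoints of one kind `Before` implies the order of T. For a source and a sink,
  -- `before-source-sink` and `before-sink-source` give contradictory conditions.
  before-asym : ∀ {p q} → Before T p q → ¬ Before T q p
  before-asym {p} {q} pq qp with source⊎sink T p | source⊎sink T q
  ... | inj₁ p′ | inj₁ q′ = ℕₚ.<-asym (before-sources p′ q′ pq) (before-sources q′ p′ qp)
  ... | inj₂ p′ | inj₂ q′ = ℕₚ.<-asym (before-sinks p′ q′ pq) (before-sinks q′ p′ qp)
  ... | inj₁ p′ | inj₂ q′ with before-source-sink p′ q′ pq | before-sink-source q′ p′ qp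
  ...   | inj₁ eq                  | ≢mate , _ = ≢mate eq
  ...   | inj₂ (r , r′ , p<r , r<q) | _ , none  = none r r′ p<r r<q
  before-asym {p} {q} pq qp | inj₂ p′ | inj₁ q′
    with before-source-sink q′ p′ qp | before-sink-source p′ q′ pq
  ...   | inj₁ eq                  | ≢mate , _ = ≢mate eq
  ...   | inj₂ (r , r′ , q<r , r<p) | _ , none  = none r r′ q<r r<p

  before-irrefl : ∀ {p q} → p ≡ q → ¬ Before T p q
  before-irrefl refl b = before-asym b b

-- D ↝ T: listing the endpoints of T with every source at the end of its
-- source-sink group gives D.
record _↝_ {n} (D T : Diagram n) : Set where
  field
    to            : Point n → Point n
    to-mate       : ∀ p → to (mate D p) ≡ mate T (to p)
    to-before     : ∀ {p q} → p Fin.< q → Before T (to p) (to q)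
    to-surjective : ∀ q → ∃[ p ] to p ≡ q

  from : Point n → Point n
  from q = proj₁ (to-surjective q)

  to-from : ∀ q → to (from q) ≡ q
  to-from q = proj₂ (to-surjective q)

  to-injective : ∀ {p q} → to p ≡ to q → p ≡ q
  to-injective {p} {q} eq with Finₚ.<-cmp p q
  ... | tri< p<q _ _ = ⊥-elim (before-irrefl T eq (to-before p<q))
  ... | tri≈ _ p≡q _ = p≡q
  ... | tri> _ _ q<p = ⊥-elim (before-irrefl T (sym eq) (to-before q<p))

  from-to : ∀ p → from (to p) ≡ p
  from-to p = to-injective (to-from (to p))

  -- A sink landed on here would precede its own source in `Before`, which no constructor allows.
  to-source : ∀ {p} → IsSource D p → IsSource T (to p)
  to-source {p} p<m with source⊎sink T (to p)
  ... | inj₁ src = src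
  ... | inj₂ snk = ⊥-elim (proj₁ (before-sink-source T snk (mate-sink T snk)
    (subst (Before T (to p)) (to-mate p) (to-before p<m))) (sym (mate-involutive T (to p))))

  to-sink : ∀ {p} → IsSink D p → IsSink T (to p)
  to-sink {p} m<p = subst (mate T (to p) Fin.<_) (mate-involutive T (to p))
    (subst (IsSource T) (to-mate p) (to-source (mate-sink D m<p)))

  from-source : ∀ {p} → IsSource T (to p) → IsSource D p
  from-source {p} src with source⊎sink D p
  ... | inj₁ src′ = src′
  ... | inj₂ snk  = ⊥-elim (ℕₚ.<-asym src (to-sink snk))

  to-sources : ∀ {p q} → IsSource D p → IsSource D q → p Fin.< q → to p Fin.< to q
  to-sources p′ q′ p<q = before-sources T (to-source p′) (to-source q′) (to-before p<q)

  to-sinks : ∀ {p q} → IsSink D p → IsSink D q → p Fin.< q → to p Fin.< to q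
  to-sinks p′ q′ p<q = before-sinks T (to-sink p′) (to-sink q′) (to-before p<q)

  from-sources : ∀ {p q} → IsSource D p → IsSource D q → to p Fin.< to q → p Fin.< q
  from-sources p′ q′ lt with <⊎> (λ eq → ℕₚ.<-irrefl (cong (toℕ ∘ to) eq) lt)
  ... | inj₁ p<q = p<q
  ... | inj₂ q<p = ⊥-elim (ℕₚ.<-asym lt (to-sources q′ p′ q<p))

  from-sinks : ∀ {p q} → IsSink D p → IsSink D q → to p Fin.< to q → p Fin.< q
  from-sinks p′ q′ lt with <⊎> (λ eq → ℕₚ.<-irrefl (cong (toℕ ∘ to) eq) lt)
  ... | inj₁ p<q = p<q
  ... | inj₂ q<p = ⊥-elim (ℕₚ.<-asym lt (to-sinks q′ p′ q<p))

  to-parted : ∀ {p q} → IsSource D p → IsSink D q → p Fin.< q → q ≢ mate D p →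
              ∃[ r ] IsSource T r × to p Fin.< r × r Fin.< to q
  to-parted {p} p′ q′ p<q q≢m
    with before-source-sink T (to-source p′) (to-sink q′) (to-before p<q)
  ... | inj₁ eq = ⊥-elim (q≢m (to-injective (trans eq (sym (to-mate p)))))
  ... | inj₂ r  = r

  to-unparted : ∀ {p q} → IsSink D p → IsSource D q → p Fin.< q →
                ∀ r → IsSource T r → to q Fin.< r → ¬ r Fin.< to p
  to-unparted p′ q′ p<q = proj₂ (before-sink-source T (to-sink p′) (to-source q′) (to-before p<q))

open _↝_

-- Both maps list the endpoints of T compatibly with `Before`. Asymmetry makes the comparison map
-- `h` increasing, hence the identity.
↝-unique : ∀ {n} {D E T : Diagram n} → D ↝ T → E ↝ T → D ≈ᴰ E
↝-unique {n} {D} {E} {T} s t p = begin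
  mate D p                 ≡⟨ from-to s (mate D p) ⟨
  from s (to s (mate D p)) ≡⟨ cong (from s) (to-mate s p) ⟩
  from s (mate T (to s p)) ≡⟨ cong (from s ∘ mate T) (same p) ⟩
  from s (mate T (to t p)) ≡⟨ cong (from s) (to-mate t p) ⟨
  from s (to t (mate E p)) ≡⟨ cong (from s) (same (mate E p)) ⟨
  from s (to s (mate E p)) ≡⟨ from-to s (mate E p) ⟩
  mate E p                 ∎
  where
  open ≡-Reasoning

  h : Point n → Point n
  h = from t ∘ to s

  to-h : ∀ p → to t (h p) ≡ to s p
  to-h p = to-from t (to s p)

  increasing : ∀ {p q} → p Fin.< q → h p Fin.< h q
  increasing {p} {q} p<q with <⊎> (λ eq → ℕₚ.<-irrefl
    (cong toℕ (to-injective s (trans (sym (to-h p)) (trans (cong (to t) eq) (to-h q))))) p<q)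
  ... | inj₁ hp<hq = hp<hq
  ... | inj₂ hq<hp = ⊥-elim (before-asym T (to-before s p<q)
    (subst₂ (Before T) (to-h q) (to-h p) (to-before t hq<hp)))

  same : ∀ p → to s p ≡ to t p
  same p = trans (sym (to-h p)) (cong (to t) (increasing⇒id h increasing p))

-- One-terminal diagrams: the last chord and the order of the rearranged word.

module _ {n : ℕ} (T : Diagram n) where

  -- Finite search turns the double negation into a witness; the later source `s` shows that the
  -- chord of `p` is not last.
  right-neighbor : OneTerminal T → ∀ {p s} → IsSource T p → IsSource T s → p Fin.< s →
    ∃[ r ] IsSource T r × p Fin.< r × r Fin.< mate T p × mate T p Fin.< mate T r
  right-neighbor one {p} {s} p′ s′ p<s with Finₚ.any? (λ r → isSource? T r ×-dec
    p Finₚ.<? r ×-dec r Finₚ.<? mate T p ×-dec mate T p Finₚ.<? mate T r)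
  ... | yes found = found
  ... | no  none  = ⊥-elim (one (chord p p′)
    (λ last → ℕₚ.<⇒≱ p<s (last (chord s s′)))
    (λ { (chord r r′) (p<r , r<m , m<m) → none (r , r′ , p<r , r<m , m<m) }))

module _ {n : ℕ} (T : Diagram (suc n)) where

  greatest : Point (suc n)
  greatest = Fin.fromℕ _

  greatest-sink : IsSink T greatest
  greatest-sink with source⊎sink T greatest
  ... | inj₁ src = ⊥-elim (ℕₚ.<⇒≱ src (Finₚ.≤fromℕ _))
  ... | inj₂ snk = snk

  -- Given a later source, the chord ending at the greatest endpoint would have a right neighbor,
  -- whose sink would lie beyond that endpoint.
  mate-greatest-last : OneTerminal T → ∀ s → IsSource T s → s Fin.≤ mate T greatest
  mate-greatest-last one s s′ = ℕₚ.≮⇒≥ λ m<s →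
    let r , _ , _ , _ , g<m = right-neighbor T one (mate-sink T greatest-sink) s′ m<s
    in ℕₚ.<⇒≱ (subst (Fin._< mate T r) (mate-involutive T greatest) g<m) (Finₚ.≤fromℕ _)

  last⇒mate-greatest : OneTerminal T → ∀ {a} → IsSource T a →
                       (∀ s → IsSource T s → s Fin.≤ a) → mate T a ≡ greatest
  last⇒mate-greatest one a′ last = mate-flip T (Finₚ.toℕ-injective (ℕₚ.≤-antisym
    (mate-greatest-last one _ a′) (last _ (mate-sink T greatest-sink))))

  private
    Increasing : List (Point (suc n)) → Set
    Increasing = AllPairs Fin._<_

    ∷-greater : ∀ {p r ps} → Increasing (p ∷ ps) → r ∈ p ∷ ps → ¬ r Fin.< p
    ∷-greater _         (here refl) r<p = ℕₚ.<-irrefl refl r<p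
    ∷-greater (p< ∷ _) (there r∈)  r<p = ℕₚ.<-asym r<p (All.lookup p< r∈)

    drop : ∀ {p r : Point (suc n)} {ps} → r ≢ p → r ∈ p ∷ ps → r ∈ ps
    drop r≢p (here eq)  = ⊥-elim (r≢p eq)
    drop r≢p (there r∈) = r∈

    >⇒≢ : ∀ {p r : Point (suc n)} → p Fin.< r → r ≢ p
    >⇒≢ p<r refl = ℕₚ.<-irrefl refl p<r

  module _ (one : OneTerminal T) where

    -- Sinks passed by `a` may already have been put down, so `a ∷ ps` can have gaps. Since every
    -- source after `a` is still in `ps`, a source missing in front of the list is missing in T, as
    -- `passed` demands. The rest of the word permutes the endpoints left, so each entry is compared
    -- with these.
    holdSource-before : ∀ {a} ps → IsSource T a → Increasing (a ∷ ps) →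
      (∀ {r} → IsSource T r → a Fin.< r → r ∈ ps) →
      AllPairs (Before T) (holdSource T a ps)
    holdSource-before     []       _  _                         _     = [] ∷ []
    holdSource-before {a} (p ∷ ps) a′ ((a<p ∷ a<) ∷ (p< ∷ ps<)) later
      with otherSink? T a p | isSource? T p
    ... | yes (p′ , p≢m) | _ =
      All-resp-↭ (↭-sym (holdSource-↭ T a ps))
        ( passed p′ a′ a<p p≢m (λ r r′ a<r → ∷-greater (p< ∷ ps<) (later r′ a<r))
        ∷ All.map (kept (λ p″ → ⊥-elim (ℕₚ.<-asym p′ p″))) p<)
      ∷ holdSource-before ps a′ (a< ∷ ps<)
          (λ r′ a<r → drop (source≢sink T r′ p′) (later r′ a<r))
    -- The source `p` itself parts `a` from everything after `p`.
    ... | no _ | yes p′ =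
      All-resp-↭ (↭-sym (holdSource-↭ T p ps))
        (kept (λ _ → p′) a<p ∷ All.map (parted p p′ a<p) p<)
      ∷ holdSource-before ps p′ (p< ∷ ps<)
          (λ r′ p<r → drop (>⇒≢ p<r) (later r′ (ℕₚ.<-trans a<p p<r)))
    ... | no ¬other | no ¬p′ = ending ps p<
      where
      p-sink : IsSink T p
      p-sink with source⊎sink T p
      ... | inj₁ p′ = ⊥-elim (¬p′ p′)
      ... | inj₂ p′ = p′

      p≡mate : p ≡ mate T a
      p≡mate with p Finₚ.≟ mate T a
      ... | yes eq = eq
      ... | no  ≢m = ⊥-elim (¬other (p-sink , ≢m))

      -- a is directly followed by its own sink, so it is terminal.
      a-last : ∀ s → IsSource T s → s Fin.≤ a
      a-last s s′ = ℕₚ.≮⇒≥ λ a<s →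
        let r , r′ , a<r , r<m , _ = right-neighbor T one a′ s′ a<s
        in ∷-greater (p< ∷ ps<) (later r′ a<r) (subst (r Fin.<_) (sym p≡mate) r<m)

      p-greatest : ∀ q → q Fin.≤ p
      p-greatest q = subst (q Fin.≤_)
        (sym (trans p≡mate (last⇒mate-greatest one a′ a-last))) (Finₚ.≤fromℕ q)

      -- The list must stop at `p`: a further sink would satisfy `passed` with respect to `a`, yet
      -- the word puts `a` first.
      ending : ∀ qs → All (p Fin.<_) qs → AllPairs (Before T) (a ∷ p ∷ moveSources T qs)
      ending []      _         = (own a′ p≡mate ∷ []) ∷ [] ∷ []
      ending (q ∷ _) (p<q ∷ _) = ⊥-elim (ℕₚ.<⇒≱ p<q (p-greatest q))

    -- The remaining list is an upper set of endpoints, so no later source is missing when a source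
    -- is picked up.
    moveSources-before : ∀ ps → Increasing ps →
      (∀ {q r} → q ∈ ps → q Fin.< r → r ∈ ps) → AllPairs (Before T) (moveSources T ps)
    moveSources-before []       _          _  = []
    moveSources-before (p ∷ ps) (p< ∷ ps<) up with isSource? T p
    ... | yes p′ = holdSource-before ps p′ (p< ∷ ps<)
      (λ _ p<r → drop (>⇒≢ p<r) (up (here refl) p<r))
    ... | no ¬p′ =
      All-resp-↭ (↭-sym (moveSources-↭ T ps)) (All.map (kept (⊥-elim ∘ ¬p′)) p<)
      ∷ moveSources-before ps ps<
          (λ q∈ q<r → drop (>⇒≢ (ℕₚ.<-trans (All.lookup p< q∈) q<r)) (up (there q∈) q<r))

    rearranged-before : AllPairs (Before T) (rearranged T)
    rearranged-before = moveSources-before _ (AllPairs.tabulate⁺-< (λ p<q → p<q))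
      (λ {_} {r} _ _ → ∈-allFin r)

AllPairs-lookup : ∀ {A : Set} {R : A → A → Set} {xs} → AllPairs R xs →
                  ∀ {i j} → i Fin.< j → R (lookup xs i) (lookup xs j)
AllPairs-lookup (Rx ∷ _)   {zero}  {suc j} _         = All.lookup Rx (∈-lookup j)
AllPairs-lookup (_  ∷ Rxs) {suc i} {suc j} (s≤s i<j) = AllPairs-lookup Rxs i<j

-- Adding a last chord

module _ {n : ℕ} where

  private
    2n+2 : 2 * n + 2 ≡ 2 * suc n
    2n+2 = trans (ℕₚ.+-comm (2 * n) 2) (sym (ℕₚ.*-suc 2 n))

  old : Point n → Point (suc n)
  old x = Fin.cast 2n+2 (x Fin.↑ˡ 2)

  newSource newSink : Point (suc n)
  newSource = Fin.cast 2n+2 (2 * n Fin.↑ʳ zero)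
  newSink   = Fin.cast 2n+2 (2 * n Fin.↑ʳ suc zero)

  toℕ-old : ∀ x → toℕ (old x) ≡ toℕ x
  toℕ-old x = trans (Finₚ.toℕ-cast 2n+2 _) (Finₚ.toℕ-↑ˡ x 2)

  toℕ-newSource : toℕ newSource ≡ 2 * n
  toℕ-newSource = trans (Finₚ.toℕ-cast 2n+2 _)
    (trans (Finₚ.toℕ-↑ʳ (2 * n) (zero {1})) (ℕₚ.+-identityʳ _))

  toℕ-newSink : toℕ newSink ≡ suc (2 * n)
  toℕ-newSink = trans (Finₚ.toℕ-cast 2n+2 _)
    (trans (Finₚ.toℕ-↑ʳ (2 * n) (suc (zero {0}))) (ℕₚ.+-comm (2 * n) 1))

  data View : Point (suc n) → Set where
    isOld       : ∀ x → View (old x)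
    isNewSource : View newSource
    isNewSink   : View newSink

  private
    split : Point (suc n) → Point n ⊎ Fin 2
    split p = Fin.splitAt (2 * n) (Fin.cast (sym 2n+2) p)

    cast-back : ∀ {p q} → q ≡ Fin.cast (sym 2n+2) p → Fin.cast 2n+2 q ≡ p
    cast-back eq = trans (cong (Fin.cast 2n+2) eq) (Finₚ.cast-involutive 2n+2 (sym 2n+2) _)

  view : ∀ p → View p
  view p with split p in eq
  ... | inj₁ x          = subst View (cast-back (Finₚ.splitAt⁻¹-↑ˡ eq)) (isOld x)
  ... | inj₂ zero       = subst View (cast-back (Finₚ.splitAt⁻¹-↑ʳ eq)) isNewSource
  ... | inj₂ (suc zero) = subst View (cast-back (Finₚ.splitAt⁻¹-↑ʳ eq)) isNewSink

  module _ {A : Set} (f : Point n → A) (s t : A) where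

    private
      pick : Point n ⊎ Fin 2 → A
      pick (inj₁ x)          = f x
      pick (inj₂ zero)       = s
      pick (inj₂ (suc zero)) = t

    -- Serves both for the matching of `D ⁺` and for the map in `ψ-↝` that sends the two new
    -- endpoints to the chord deleted by ψ.
    extend : Point (suc n) → A
    extend = pick ∘ split

    extend-old : ∀ x → extend (old x) ≡ f x
    extend-old x = cong pick (trans
      (cong (Fin.splitAt (2 * n)) (Finₚ.cast-involutive (sym 2n+2) 2n+2 (x Fin.↑ˡ 2)))
      (Finₚ.splitAt-↑ˡ (2 * n) x 2))

    extend-newSource : extend newSource ≡ s
    extend-newSource = cong pick (trans
      (cong (Fin.splitAt (2 * n)) (Finₚ.cast-involutive (sym 2n+2) 2n+2 (2 * n Fin.↑ʳ zero)))
      (Finₚ.splitAt-↑ʳ (2 * n) 2 zero))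

    extend-newSink : extend newSink ≡ t
    extend-newSink = cong pick (trans
      (cong (Fin.splitAt (2 * n)) (Finₚ.cast-involutive (sym 2n+2) 2n+2 (2 * n Fin.↑ʳ suc zero)))
      (Finₚ.splitAt-↑ʳ (2 * n) 2 (suc zero)))

  old-< : ∀ {x y} → x Fin.< y → old x Fin.< old y
  old-< {x} {y} = subst₂ _<_ (sym (toℕ-old x)) (sym (toℕ-old y))

  old-<⁻¹ : ∀ {x y} → old x Fin.< old y → x Fin.< y
  old-<⁻¹ {x} {y} = subst₂ _<_ (toℕ-old x) (toℕ-old y)

  old<newSource : ∀ x → old x Fin.< newSource
  old<newSource x = subst₂ _<_ (sym (toℕ-old x)) (sym toℕ-newSource) (Finₚ.toℕ<n x)

  newSource<newSink : newSource Fin.< newSink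
  newSource<newSink = subst₂ _<_ (sym toℕ-newSource) (sym toℕ-newSink) ℕₚ.≤-refl

  old<newSink : ∀ x → old x Fin.< newSink
  old<newSink x = ℕₚ.<-trans (old<newSource x) newSource<newSink

  old-injective : ∀ {x y} → old x ≡ old y → x ≡ y
  old-injective {x} {y} eq = Finₚ.toℕ-injective
    (trans (sym (toℕ-old x)) (trans (cong toℕ eq) (toℕ-old y)))

  module _ (D : Diagram n) where

    private
      mate⁺ : Point (suc n) → Point (suc n)
      mate⁺ = extend (old ∘ mate D) newSink newSource

      mate⁺-old       = extend-old       (old ∘ mate D) newSink newSource
      mate⁺-newSource = extend-newSource (old ∘ mate D) newSink newSource
      mate⁺-newSink   = extend-newSink   (old ∘ mate D) newSink newSource

    infix 30 _⁺
    -- Puts back, at the end, the chord that ψ deletes.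
    _⁺ : Diagram (suc n)
    _⁺ = record
      { mate             = mate⁺
      ; mate-involutive  = λ p → involutive (view p)
      ; mate-irreflexive = λ p → irreflexive (view p)
      }
      where
      involutive : ∀ {p} → View p → mate⁺ (mate⁺ p) ≡ p
      involutive (isOld x)   = trans (cong mate⁺ (mate⁺-old x))
        (trans (mate⁺-old (mate D x)) (cong old (mate-involutive D x)))
      involutive isNewSource = trans (cong mate⁺ mate⁺-newSource) mate⁺-newSink
      involutive isNewSink   = trans (cong mate⁺ mate⁺-newSink) mate⁺-newSource

      irreflexive : ∀ {p} → View p → mate⁺ p ≢ p
      irreflexive (isOld x)   eq = mate-irreflexive D x
        (old-injective (trans (sym (mate⁺-old x)) eq))
      irreflexive isNewSource eq = ℕₚ.<-irrefl
        (cong toℕ (trans (sym eq) mate⁺-newSource)) newSource<newSink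
      irreflexive isNewSink   eq = ℕₚ.<-irrefl
        (cong toℕ (trans (sym mate⁺-newSink) eq)) newSource<newSink

    mate-old : ∀ x → mate _⁺ (old x) ≡ old (mate D x)
    mate-old = mate⁺-old

    mate-newSource : mate _⁺ newSource ≡ newSink
    mate-newSource = mate⁺-newSource

    mate-newSink : mate _⁺ newSink ≡ newSource
    mate-newSink = mate⁺-newSink

    newSource-source : IsSource _⁺ newSource
    newSource-source = subst (newSource Fin.<_) (sym mate-newSource) newSource<newSink

⁺-cong : ∀ {n} {D E : Diagram n} → D ≈ᴰ E → (D ⁺) ≈ᴰ (E ⁺)
⁺-cong {D = D} {E} eq p with view p
... | isOld x     = trans (mate-old D x) (trans (cong old (eq x)) (sym (mate-old E x)))
... | isNewSource = trans (mate-newSource D) (sym (mate-newSource E))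
... | isNewSink   = trans (mate-newSink D) (sym (mate-newSink E))

⁺-injective : ∀ {n} {D E : Diagram n} → (D ⁺) ≈ᴰ (E ⁺) → D ≈ᴰ E
⁺-injective {D = D} {E} eq x = old-injective
  (trans (sym (mate-old D x)) (trans (eq (old x)) (mate-old E x)))

-- Filtering keeps the order of the rearranged word. It remains that all other endpoints come before
-- `s` and `t`, which holds because no source follows `s` and no endpoint follows `t`.
ψ-↝ : ∀ {n} (T : OneTerminalDiagram (suc n)) → (ψ T ⁺) ↝ proj₁ T
ψ-↝ {n} T₁@(T , one) = record
  { to            = to′
  ; to-mate       = λ p → to-mate′ (view p)
  ; to-before     = λ {p} {q} → to-before′ (view p) (view q)
  ; to-surjective = surjective
  }
  where
  c : Chord T
  c = proj₁ (lastChord T)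

  open Chord c renaming (source to s; sink to t; source<sink to s′)

  at′ : Point n → Point (suc n)
  at′ = at {m = n} T (ψ-word T) (ψ-word-unique T) (ψ-word-closed T) (ψ-word-length T)

  to′ : Point (suc n) → Point (suc n)
  to′ = extend {n} at′ s t

  to-old : ∀ x → to′ (old x) ≡ at′ x
  to-old = extend-old {n} at′ s t

  to-newSource : to′ newSource ≡ s
  to-newSource = extend-newSource {n} at′ s t

  to-newSink : to′ newSink ≡ t
  to-newSink = extend-newSink {n} at′ s t

  to-mate′ : ∀ {p} → View p → to′ (mate (ψ T₁ ⁺) p) ≡ mate T (to′ p)
  to-mate′ (isOld x) = begin
    to′ (mate (ψ T₁ ⁺) (old x)) ≡⟨ cong to′ (mate-old (ψ T₁) x) ⟩
    to′ (old (mate (ψ T₁) x))   ≡⟨ to-old (mate (ψ T₁) x) ⟩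
    at′ (mate (ψ T₁) x)         ≡⟨ at-relabelled-mate {m = n} T _
                                    (ψ-word-unique T) (ψ-word-closed T) (ψ-word-length T) x ⟩
    mate T (at′ x)              ≡⟨ cong (mate T) (to-old x) ⟨
    mate T (to′ (old x))        ∎
    where open ≡-Reasoning
  to-mate′ isNewSource = trans (cong to′ (mate-newSource (ψ T₁)))
    (trans to-newSink (cong (mate T) (sym to-newSource)))
  to-mate′ isNewSink = trans (cong to′ (mate-newSink (ψ T₁)))
    (trans to-newSource (trans (sym (mate-involutive T s)) (cong (mate T) (sym to-newSink))))

  s-last : ∀ q → IsSource T q → q Fin.≤ s
  s-last q q′ = proj₂ (lastChord T) (chord q q′)

  t-greatest : ∀ q → q Fin.≤ t
  t-greatest q = subst (q Fin.≤_) (sym (last⇒mate-greatest T one s′ s-last)) (Finₚ.≤fromℕ q)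

  before-s : ∀ {q} → q ≢ s → q ≢ t → Before T q s
  before-s {q} q≢s q≢t with <⊎> q≢s
  ... | inj₁ q<s = kept (λ _ → s′) q<s
  ... | inj₂ s<q with source⊎sink T q
  ...   | inj₁ q′ = ⊥-elim (ℕₚ.<⇒≱ s<q (s-last q q′))
  -- No source follows `s`, so a foreign sink after `s` lies in its group.
  ...   | inj₂ q′ = passed q′ s′ s<q q≢t λ r r′ s<r _ → ℕₚ.<⇒≱ s<r (s-last r r′)

  before-t : ∀ {q} → q ≢ s → q ≢ t → Before T q t
  before-t {q} q≢s q≢t with source⊎sink T q
  -- `s` parts `q` from `t`; the final `s′` is read as `s < t`.
  ... | inj₁ q′ = parted s s′ (ℕₚ.≤∧≢⇒< (s-last q q′) (q≢s ∘ Finₚ.toℕ-injective)) s′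
  ... | inj₂ q′ = kept (λ q″ → ⊥-elim (ℕₚ.<-asym q′ q″))
    (ℕₚ.≤∧≢⇒< (t-greatest q) (q≢t ∘ Finₚ.toℕ-injective))

  at-off : ∀ x → at′ x ≢ s × at′ x ≢ t
  at-off x = proj₂ (∈-filter⁻ (offChord? T c) {xs = rearranged T}
    (at∈ws {m = n} T _ (ψ-word-unique T) (ψ-word-closed T) (ψ-word-length T) x))

  at-before : ∀ {x y} → x Fin.< y → Before T (at′ x) (at′ y)
  at-before {x} {y} x<y = AllPairs-lookup (AllPairs.filter⁺ (offChord? T c) (rearranged-before T one))
    (subst₂ _<_ (sym (Finₚ.toℕ-cast _ x)) (sym (Finₚ.toℕ-cast _ y)) x<y)

  to-before′ : ∀ {p q} → View p → View q → p Fin.< q → Before T (to′ p) (to′ q)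
  to-before′ (isOld x) (isOld y) x<y =
    subst₂ (Before T) (sym (to-old x)) (sym (to-old y)) (at-before (old-<⁻¹ x<y))
  to-before′ (isOld x) isNewSource _ =
    subst₂ (Before T) (sym (to-old x)) (sym to-newSource)
      (before-s (proj₁ (at-off x)) (proj₂ (at-off x)))
  to-before′ (isOld x) isNewSink _ =
    subst₂ (Before T) (sym (to-old x)) (sym to-newSink)
      (before-t (proj₁ (at-off x)) (proj₂ (at-off x)))
  to-before′ isNewSource isNewSink _ =
    subst₂ (Before T) (sym to-newSource) (sym to-newSink) (own s′ refl)
  to-before′ isNewSource (isOld x)   lt = ⊥-elim (ℕₚ.<-asym lt (old<newSource x))
  to-before′ isNewSource isNewSource lt = ⊥-elim (ℕₚ.<-irrefl refl lt)
  to-before′ isNewSink   (isOld x)   lt = ⊥-elim (ℕₚ.<-asym lt (old<newSink x))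
  to-before′ isNewSink   isNewSource lt = ⊥-elim (ℕₚ.<-asym lt newSource<newSink)
  to-before′ isNewSink   isNewSink   lt = ⊥-elim (ℕₚ.<-irrefl refl lt)

  surjective : ∀ q → ∃[ p ] to′ p ≡ q
  surjective q with q Finₚ.≟ s | q Finₚ.≟ t
  ... | yes refl | _        = newSource , to-newSource
  ... | no _     | yes refl = newSink , to-newSink
  ... | no q≢s   | no q≢t   =
    old (position {m = n} T _ (ψ-word-unique T) (ψ-word-closed T) (ψ-word-length T) q∈) ,
    trans (to-old _) (at-position {m = n} T _ (ψ-word-unique T) (ψ-word-closed T) (ψ-word-length T) q∈)
    where
    q∈ = ∈-filter⁺ (offChord? T c) (∈-resp-↭ (↭-sym (moveSources-↭ T _)) (∈-allFin q)) (q≢s , q≢t)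

-- Undoing the rearrangement

module _ {n : ℕ} (D : Diagram n) where

  private
    SourceAt : ℕ → Set
    SourceAt k = Σ[ s ∈ Point n ] toℕ s ≡ k × IsSource D s

    sourceAt? : Decidable SourceAt
    sourceAt? k = Finₚ.any? λ s → (toℕ s ℕₚ.≟ k) ×-dec isSource? D s

  -- One more than the position of the last source before k, or 0 if there is none.
  afterSource : ℕ → ℕ
  afterSource zero    = 0
  afterSource (suc k) with sourceAt? k
  ... | yes _ = suc k
  ... | no  _ = afterSource k

  afterSource-≤ : ∀ k → afterSource k ≤ k
  afterSource-≤ zero    = z≤n
  afterSource-≤ (suc k) with sourceAt? k
  ... | yes _ = ℕₚ.≤-refl
  ... | no  _ = ℕₚ.m≤n⇒m≤1+n (afterSource-≤ k)

  source<afterSource : ∀ {s k} → IsSource D s → toℕ s < k → toℕ s < afterSource k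
  source<afterSource {s} {suc k} s′ (s≤s s≤k) with sourceAt? k
  ... | yes _   = s≤s s≤k
  ... | no none = source<afterSource s′ (ℕₚ.≤∧≢⇒< s≤k λ eq → none (s , eq , s′))

  afterSource-attained : ∀ {j} k → j < afterSource k →
                         Σ[ s ∈ Point n ] IsSource D s × j ≤ toℕ s × toℕ s < k
  afterSource-attained (suc k) j< with sourceAt? k
  ... | yes (s , refl , s′) = s , s′ , ℕₚ.≤-pred j< , ℕₚ.≤-refl
  ... | no _ = let s , s′ , j≤s , s<k = afterSource-attained k j<
               in s , s′ , j≤s , ℕₚ.m≤n⇒m≤1+n s<k

  -- Undoing the rearrangement moves a source to just after the previous
  -- source, and so every sink by one place; a new source is then first.
  key : Point n → ℕ
  key p with isSource? D p
  ... | yes _ = afterSource (toℕ p)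
  ... | no  _ = suc (toℕ p)

  key-source : ∀ {p} → IsSource D p → key p ≡ afterSource (toℕ p)
  key-source {p} p′ with isSource? D p
  ... | yes _  = refl
  ... | no ¬p′ = ⊥-elim (¬p′ p′)

  key-sink : ∀ {p} → IsSink D p → key p ≡ suc (toℕ p)
  key-sink {p} p′ with isSource? D p
  ... | yes p″ = ⊥-elim (ℕₚ.<-asym p′ p″)
  ... | no _   = refl

  key-sources : ∀ {p q} → IsSource D p → IsSource D q → p Fin.< q → key p < key q
  key-sources p′ q′ p<q = subst₂ _<_ (sym (key-source p′)) (sym (key-source q′))
    (ℕₚ.≤-<-trans (afterSource-≤ _) (source<afterSource p′ p<q))

  key-sinks : ∀ {p q} → IsSink D p → IsSink D q → p Fin.< q → key p < key q
  key-sinks p′ q′ p<q = subst₂ _<_ (sym (key-sink p′)) (sym (key-sink q′)) (s≤s p<q)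

  -- The sources r with q < r < p are the obstructions to key p < key q.
  key-source-sink : ∀ {p q} → IsSource D p → IsSink D q →
    (∀ {r} → IsSource D r → q Fin.< r → ¬ r Fin.< p) → key p < key q
  key-source-sink p′ q′ none = subst₂ _<_ (sym (key-source p′)) (sym (key-sink q′))
    (s≤s (ℕₚ.≮⇒≥ λ q<a → let r , r′ , q≤r , r<p = afterSource-attained _ q<a in
      none r′ (ℕₚ.≤∧≢⇒< q≤r λ eq → source≢sink D r′ q′ (sym (Finₚ.toℕ-injective eq))) r<p))

  key-sink-source : ∀ {p q r} → IsSink D p → IsSource D q →
    IsSource D r → p Fin.< r → r Fin.< q → key p < key q
  key-sink-source p′ q′ r′ p<r r<q = subst₂ _<_ (sym (key-sink p′)) (sym (key-source q′))
    (ℕₚ.≤-<-trans p<r (source<afterSource r′ r<q))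

  -- A positive value of `afterSource` is one more than the position of a source, so equality would
  -- put a source at `q`.
  key-source≢sink : ∀ {p q} → IsSource D p → IsSink D q → key p ≢ key q
  key-source≢sink {p} {q} p′ q′ eq =
    let a≡1+q = trans (sym (key-source p′)) (trans eq (key-sink q′))
        r , r′ , q≤r , r<p = afterSource-attained (toℕ p) (ℕₚ.≤-reflexive (sym a≡1+q))
        r≤q = ℕₚ.≤-pred (subst (toℕ r <_) a≡1+q (source<afterSource r′ r<p))
    in source≢sink D r′ q′ (Finₚ.toℕ-injective (ℕₚ.≤-antisym r≤q q≤r))

  key-injective : ∀ {p q} → key p ≡ key q → p ≡ q
  key-injective {p} {q} eq with source⊎sink D p | source⊎sink D q | Finₚ.<-cmp p q
  ... | _       | _       | tri≈ _ p≡q _ = p≡q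
  ... | inj₁ p′ | inj₁ q′ | tri< p<q _ _ = ⊥-elim (ℕₚ.<-irrefl eq (key-sources p′ q′ p<q))
  ... | inj₁ p′ | inj₁ q′ | tri> _ _ q<p = ⊥-elim (ℕₚ.<-irrefl (sym eq) (key-sources q′ p′ q<p))
  ... | inj₂ p′ | inj₂ q′ | tri< p<q _ _ = ⊥-elim (ℕₚ.<-irrefl eq (key-sinks p′ q′ p<q))
  ... | inj₂ p′ | inj₂ q′ | tri> _ _ q<p = ⊥-elim (ℕₚ.<-irrefl (sym eq) (key-sinks q′ p′ q<p))
  ... | inj₁ p′ | inj₂ q′ | _            = ⊥-elim (key-source≢sink p′ q′ eq)
  ... | inj₂ p′ | inj₁ q′ | _            = ⊥-elim (key-source≢sink q′ p′ (sym eq))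

-- A one-terminal diagram is determined by its rearrangement.

module _ {n : ℕ} {D T : Diagram n} (one : OneTerminal T) (s : D ↝ T) where

  private
    -- r corresponds to the last source before to p, whose group contains to p.
    parting : ∀ {p q} → IsSink D p → IsSource D q → to s p Fin.< to s q →
              ∃[ r ] IsSource D r × p Fin.< r × r Fin.< q
    parting {p} {q} p′ q′ sp<sq
      with maximiser toℕ (λ r → isSource? T r ×-dec r Finₚ.<? to s p)
             (_ , mate-sink T (to-sink s p′) , to-sink s p′)
    ... | g , (g′ , g<sp) , max = r , r′ , p<r , r<q
      where
      r = from s g

      sr≡g : to s r ≡ g
      sr≡g = to-from s g

      r′ : IsSource D r
      r′ = from-source s (subst (IsSource T) (sym sr≡g) g′)

      r<q : r Fin.< q
      r<q = from-sources s r′ q′ (subst (Fin._< to s q) (sym sr≡g) (ℕₚ.<-trans g<sp sp<sq))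

      nothing-between : ∀ {h} → IsSource T h → g Fin.< h → ¬ h Fin.< to s p
      nothing-between h′ g<h h<sp = ℕₚ.<⇒≱ g<h (max _ (h′ , h<sp))

      p<r : p Fin.< r
      p<r with <⊎> (source≢sink D r′ p′)
      ... | inj₂ p<r = p<r
      ... | inj₁ r<p with before-source-sink T g′ (to-sink s p′)
                            (subst (λ x → Before T x (to s p)) sr≡g (to-before s r<p))
      ...   | inj₂ (h , h′ , g<h , h<sp) = ⊥-elim (nothing-between h′ g<h h<sp)
      ...   | inj₁ sp≡m =
        let h , h′ , g<h , h<m , _ = right-neighbor T one g′ (to-source s q′) (ℕₚ.<-trans g<sp sp<sq)
        in ⊥-elim (nothing-between h′ g<h (subst (h Fin.<_) (sym sp≡m) h<m))

  -- `key` depends on D alone, so the order of T can be recovered from D. In the mixed cases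
  -- `to-unparted` excludes the obstruction and `parting` supplies the separating source.
  ↝-key : ∀ {p q} → to s p Fin.< to s q → key D p < key D q
  ↝-key {p} {q} sp<sq with source⊎sink D p | source⊎sink D q
  ... | inj₁ p′ | inj₁ q′ = key-sources D p′ q′ (from-sources s p′ q′ sp<sq)
  ... | inj₂ p′ | inj₂ q′ = key-sinks D p′ q′ (from-sinks s p′ q′ sp<sq)
  ... | inj₁ p′ | inj₂ q′ = key-source-sink D p′ q′ λ r′ q<r r<p →
    to-unparted s q′ r′ q<r (to s p) (to-source s p′) (to-sources s r′ p′ r<p) sp<sq
  ... | inj₂ p′ | inj₁ q′ = let r , r′ , p<r , r<q = parting p′ q′ sp<sq in
    key-sink-source D p′ q′ r′ p<r r<q

-- The same keys of D govern the orders of T and U, so the comparison map `h` is increasing, hence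
-- the identity.
↝-injective : ∀ {n} {D T U : Diagram n} → OneTerminal T → OneTerminal U →
              D ↝ T → D ↝ U → T ≈ᴰ U
↝-injective {n} {D} {T} {U} oneT oneU s t p = begin
  mate T p                 ≡⟨ cong (mate T) (to-from s p) ⟨
  mate T (to s (from s p)) ≡⟨ to-mate s (from s p) ⟨
  to s (mate D (from s p)) ≡⟨ same _ ⟩
  to t (mate D (from s p)) ≡⟨ to-mate t (from s p) ⟩
  mate U (to t (from s p)) ≡⟨ cong (mate U) (h≡id p) ⟩
  mate U p                 ∎
  where
  open ≡-Reasoning

  h : Point n → Point n
  h = to t ∘ from s

  increasing : ∀ {p q} → p Fin.< q → h p Fin.< h q
  increasing {p} {q} p<q with <⊎> (λ eq → ℕₚ.<-irrefl (cong toℕ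
    (trans (sym (to-from s p)) (trans (cong (to s) (to-injective t eq)) (to-from s q)))) p<q)
  ... | inj₁ hp<hq = hp<hq
  ... | inj₂ hq<hp = ⊥-elim (ℕₚ.<-asym (↝-key oneU t hq<hp)
    (↝-key oneT s (subst₂ Fin._<_ (sym (to-from s p)) (sym (to-from s q)) p<q)))

  h≡id : ∀ p → h p ≡ p
  h≡id = increasing⇒id h increasing

  same : ∀ p → to s p ≡ to t p
  same p = trans (sym (h≡id (to s p))) (cong (to t) (from-to s p))


-- Sorting by keys gives a one-terminal diagram with the prescribed rearrangement.

module Unmove {n : ℕ} (D : Diagram n) where

  private
    byKey : DecTotalOrder _ _ _
    byKey = On.decTotalOrder ℕₚ.≤-decTotalOrder (key D)

    open Sort byKey using (sort; sort-↭; sort-↗)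

    word : List (Point n)
    word = sort (allFin (2 * n))

    all∈ : ∀ p → p ∈ word
    all∈ p = ∈-resp-↭ (↭-sym (sort-↭ _)) (∈-allFin p)

    unique : Unique word
    unique = Unique-resp-↭ (setoid _) (↭⇒↭ₛ (↭-sym (sort-↭ _))) (Unique.allFin⁺ _)

    closed : ∀ {p} → p ∈ word → mate D p ∈ word
    closed {p} _ = all∈ (mate D p)

    len : length word ≡ 2 * n
    len = trans (↭-length (sort-↭ _)) (length-tabulate {n = 2 * n} (λ i → i))

  abstract
    unmove : Diagram n
    unmove = relabel D word unique closed len

    at′ : Point n → Point n
    at′ = at {m = n} D word unique closed len

    pos : Point n → Point n
    pos p = position {m = n} D word unique closed len (all∈ p)

    at-pos : ∀ p → at′ (pos p) ≡ p
    at-pos p = at-position {m = n} D word unique closed len (all∈ p)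

    at′-injective : ∀ {k l} → at′ k ≡ at′ l → k ≡ l
    at′-injective = at-injective {m = n} D word unique closed len

    at-mate : ∀ k → at′ (mate unmove k) ≡ mate D (at′ k)
    at-mate = at-relabelled-mate {m = n} D word unique closed len

    at-key-≤ : ∀ {k l} → k Fin.< l → key D (at′ k) ≤ key D (at′ l)
    at-key-≤ {k} {l} k<l = AllPairs-lookup
      (Sorted.Sorted⇒AllPairs (DecTotalOrder.totalOrder byKey) (sort-↗ (allFin (2 * n))))
      (subst₂ _<_ (sym (Finₚ.toℕ-cast _ k)) (sym (Finₚ.toℕ-cast _ l)) k<l)

  private
    pos-at : ∀ k → pos (at′ k) ≡ k
    pos-at k = at′-injective (at-pos (at′ k))

    pos-injective : ∀ {p q} → pos p ≡ pos q → p ≡ q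
    pos-injective {p} {q} eq = trans (sym (at-pos p)) (trans (cong at′ eq) (at-pos q))

    pos-mate : ∀ p → pos (mate D p) ≡ mate unmove (pos p)
    pos-mate p = at′-injective (trans (at-pos (mate D p)) (sym (trans
      (at-mate (pos p)) (cong (mate D) (at-pos p)))))

    at-key : ∀ {k l} → k Fin.< l → key D (at′ k) < key D (at′ l)
    at-key {k} {l} k<l = ℕₚ.≤∧≢⇒< (at-key-≤ k<l)
      λ eq → ℕₚ.<-irrefl (cong toℕ (at′-injective (key-injective D eq))) k<l

    pos-key : ∀ {p q} → pos p Fin.< pos q → key D p < key D q
    pos-key {p} {q} lt = subst₂ (λ x y → key D x < key D y) (at-pos p) (at-pos q) (at-key lt)

    key-pos : ∀ {p q} → key D p < key D q → pos p Fin.< pos q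
    key-pos {p} {q} lt with <⊎> (λ eq → ℕₚ.<-irrefl (cong (key D) (pos-injective eq)) lt)
    ... | inj₁ p<q = p<q
    ... | inj₂ q<p = ⊥-elim (ℕₚ.<-asym lt (pos-key q<p))

    key-mate : ∀ {p} → IsSource D p → key D p < key D (mate D p)
    key-mate p′ = key-source-sink D p′ (mate-source D p′)
      λ _ m<r r<p → ℕₚ.<-asym p′ (ℕₚ.<-trans m<r r<p)

    pos-source : ∀ {p} → IsSource D p → IsSource unmove (pos p)
    pos-source {p} p′ = subst (pos p Fin.<_) (pos-mate p) (key-pos (key-mate p′))

    pos-sink : ∀ {p} → IsSink D p → IsSink unmove (pos p)
    pos-sink {p} p′ = subst (Fin._< pos p) (pos-mate p)
      (key-pos (subst (λ x → key D (mate D p) < key D x) (mate-involutive D p)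
        (key-mate (mate-sink D p′))))

    source-pos : ∀ {p} → IsSource unmove (pos p) → IsSource D p
    source-pos {p} pos′ with source⊎sink D p
    ... | inj₁ p′ = p′
    ... | inj₂ p′ = ⊥-elim (ℕₚ.<-asym pos′ (pos-sink p′))

    source-pos-< : ∀ {p q} → IsSource D p → IsSource D q → pos p Fin.< pos q → p Fin.< q
    source-pos-< p′ q′ lt with <⊎> (λ eq → ℕₚ.<-irrefl (cong (toℕ ∘ pos) eq) lt)
    ... | inj₁ p<q = p<q
    ... | inj₂ q<p = ⊥-elim (ℕₚ.<-asym (pos-key lt) (key-sources D q′ p′ q<p))

  -- The last two endpoints form a chord, as they do in `D ⁺`. Every other endpoint is then followed
  -- by a source, so `nextSource` applies to it.
  module _ {a : Point n} (a′ : IsSource D a) (end : ∀ q → a Fin.< q → q ≡ mate D a) where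

    private
      nextSource : ∀ {p : Point n} → p Fin.< a → Σ[ r ∈ Point n ] IsSource D r × p Fin.< r ×
                   (∀ {s} → IsSource D s → p Fin.< s → ¬ s Fin.< r)
      nextSource {p} p<a with minimum (λ r → isSource? D r ×-dec p Finₚ.<? r) (a , a′ , p<a)
      ... | r , (r′ , p<r) , min = r , r′ , p<r , λ s′ p<s → ℕₚ.≤⇒≯ (min _ (s′ , p<s))

      source≤a : ∀ {p} → IsSource D p → p Fin.≤ a
      source≤a {p} p′ = ℕₚ.≮⇒≥ λ a<p →
        source≢sink D p′ (mate-source D a′) (end p a<p)

      <a : ∀ {p} → p ≢ a → p ≢ mate D a → p Fin.< a
      <a p≢a p≢m with <⊎> p≢a
      ... | inj₁ p<a = p<a
      ... | inj₂ a<p = ⊥-elim (p≢m (end _ a<p))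

    pos-before : ∀ {p q} → p Fin.< q → Before unmove (pos p) (pos q)
    pos-before {p} {q} p<q with source⊎sink D p | source⊎sink D q
    ... | inj₁ p′ | inj₁ q′ = kept (λ _ → pos-source q′) (key-pos (key-sources D p′ q′ p<q))
    ... | inj₂ p′ | inj₂ q′ =
      kept (λ src → ⊥-elim (ℕₚ.<-asym src (pos-sink p′))) (key-pos (key-sinks D p′ q′ p<q))
    ... | inj₁ p′ | inj₂ q′ with q Finₚ.≟ mate D p
    ...   | yes refl = own (pos-source p′) (pos-mate p)
    ...   | no q≢m =
      -- The first source `r` after `p` has its key between those of `p` and `q`, whether it comes
      -- before or after `q` in D.
      let p<a = <a (λ { refl → q≢m (end q p<q) })
                   (source≢sink D p′ (mate-source D a′))
          r , r′ , p<r , none = nextSource p<a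
      in parted (pos r) (pos-source r′) (key-pos (key-sources D p′ r′ p<r))
           (key-pos (key-source-sink D r′ q′ λ s′ q<s → none s′ (ℕₚ.<-trans p<q q<s)))
    pos-before {p} {q} p<q | inj₂ p′ | inj₁ q′
      with <⊎> (λ eq → ℕₚ.<-irrefl (cong toℕ (pos-injective {p} {q} eq)) p<q)
    ... | inj₁ lt = kept (λ _ → pos-source q′) lt
    ... | inj₂ gt = passed (pos-sink p′) (pos-source q′) gt
      (λ eq → ℕₚ.<-asym p<q (subst (q Fin.<_) (sym (pos-injective (trans eq (sym (pos-mate q))))) q′))
      -- A source between the two would come after `q` in D. Then `q` separates it from the sink
      -- `p`, which therefore has the smaller key.
      λ r r′ q<r r<p →
        let s′ = source-pos (subst (IsSource unmove) (sym (pos-at r)) r′)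
            q<s = source-pos-< q′ s′ (subst (pos q Fin.<_) (sym (pos-at r)) q<r)
        in ℕₚ.<-asym r<p (subst (pos p Fin.<_) (pos-at r)
             (key-pos (key-sink-source D p′ s′ q′ p<q q<s)))

    unmove-↝ : D ↝ unmove
    unmove-↝ = record
      { to            = pos
      ; to-mate       = pos-mate
      ; to-before     = pos-before
      ; to-surjective = λ q → at′ q , pos-at q
      }

    -- The right neighbor is the chord of the first source after the sink in D: undoing the
    -- rearrangement moves that source ahead of this sink, while the order of the sinks is kept.
    unmove-oneTerminal : OneTerminal unmove
    unmove-oneTerminal (chord k k′) = subst
      (λ k → (k′ : IsSource unmove k) → ¬ IsLast unmove (chord k k′) → ¬ Terminal unmove (chord k k′))
      (pos-at k) (oneTerminal (at′ k)) k′
      where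
      oneTerminal : ∀ x → (k′ : IsSource unmove (pos x)) →
        ¬ IsLast unmove (chord (pos x) k′) → ¬ Terminal unmove (chord (pos x) k′)
      oneTerminal x k′ notLast terminal =
        terminal (chord (pos r) (pos-source r′))
          ( key-pos (key-sources D x′ r′ (ℕₚ.<-trans x′ m<r))
          , subst (pos r Fin.<_) (pos-mate x)
              (key-pos (key-source-sink D r′ (mate-source D x′) none))
          , subst₂ Fin._<_ (pos-mate x) (pos-mate r)
              (key-pos (key-sinks D (mate-source D x′) (mate-source D r′) (ℕₚ.<-trans m<r r′))))
        where
        x′ : IsSource D x
        x′ = source-pos k′

        x≢a : x ≢ a
        x≢a refl = notLast λ (chord l l′) → ℕₚ.≮⇒≥ λ x<l →
          let y′ = source-pos (subst (IsSource unmove) (sym (pos-at l)) l′)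
          in ℕₚ.<⇒≱ (source-pos-< x′ y′ (subst (pos x Fin.<_) (sym (pos-at l)) x<l)) (source≤a y′)

        next = nextSource (<a (λ eq → source≢sink D a′ (mate-source D x′) (sym eq))
                              (x≢a ∘ mate-injective D))
        r    = proj₁ next
        r′   = proj₁ (proj₂ next)
        m<r  = proj₁ (proj₂ (proj₂ next))
        none = λ {s} → proj₂ (proj₂ (proj₂ next)) {s}

-- Crossings and top cycles

module _ {n : ℕ} {D : Diagram n} where

  noncrossing⇒uncrossed : Noncrossing D → ∀ {x y} →
    x Fin.< y → y Fin.< mate D x → ¬ mate D x Fin.< mate D y
  noncrossing⇒uncrossed nc x<y y<mx mx<my =
    nc (chord _ (ℕₚ.<-trans x<y y<mx)) (chord _ (ℕₚ.<-trans y<mx mx<my)) (inj₁ (x<y , y<mx , mx<my))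

  uncrossed⇒noncrossing :
    (∀ {x y} → x Fin.< y → y Fin.< mate D x → ¬ mate D x Fin.< mate D y) → Noncrossing D
  uncrossed⇒noncrossing un _ _ (inj₁ (x<y , y<mx , mx<my)) = un x<y y<mx mx<my
  uncrossed⇒noncrossing un _ _ (inj₂ (x<y , y<mx , mx<my)) = un x<y y<mx mx<my

⁺-noncrossing : ∀ {n} {D : Diagram n} → Noncrossing D → Noncrossing (D ⁺)
⁺-noncrossing {D = D} nc = uncrossed⇒noncrossing λ {x} {y} → un (view x) (view y)
  where
  un : ∀ {x y} → View x → View y →
       x Fin.< y → y Fin.< mate (D ⁺) x → ¬ mate (D ⁺) x Fin.< mate (D ⁺) y
  un (isOld x) (isOld y) x<y y<mx mx<my =
    noncrossing⇒uncrossed nc (old-<⁻¹ x<y)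
      (old-<⁻¹ (subst (old y Fin.<_) (mate-old D x) y<mx))
      (old-<⁻¹ (subst₂ Fin._<_ (mate-old D x) (mate-old D y) mx<my))
  un (isOld x) isNewSource _ y<mx _ = ℕₚ.<-asym (old<newSource (mate D x))
    (subst (newSource Fin.<_) (mate-old D x) y<mx)
  un (isOld x) isNewSink _ y<mx _ = ℕₚ.<-asym (old<newSink (mate D x))
    (subst (newSink Fin.<_) (mate-old D x) y<mx)
  un isNewSource (isOld y) x<y _ _ = ℕₚ.<-asym x<y (old<newSource y)
  un isNewSource isNewSource x<y _ _ = ℕₚ.<-irrefl refl x<y
  un isNewSource isNewSink _ y<mx _ = ℕₚ.<-irrefl (cong toℕ (sym (mate-newSource D))) y<mx
  un isNewSink (isOld y) x<y _ _ = ℕₚ.<-asym x<y (old<newSink y)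
  un isNewSink isNewSource x<y _ _ = ℕₚ.<-asym x<y newSource<newSink
  un isNewSink isNewSink x<y _ _ = ℕₚ.<-irrefl refl x<y

⁺-noncrossing⁻¹ : ∀ {n} {D : Diagram n} → Noncrossing (D ⁺) → Noncrossing D
⁺-noncrossing⁻¹ {D = D} nc = uncrossed⇒noncrossing λ {x} {y} x<y y<mx mx<my →
  noncrossing⇒uncrossed nc (old-< x<y)
    (subst (old y Fin.<_) (sym (mate-old D x)) (old-< y<mx))
    (subst₂ Fin._<_ (sym (mate-old D x)) (sym (mate-old D y)) (old-< mx<my))

-- The crossings of T that survive in D are those with a source between the
-- source of the right neighbor and the sink of the left one.
PartedCrossing : ∀ {n} (T : Diagram n) (u v r : Point n) → Set
PartedCrossing T u v r = IsSource T r ×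
  u Fin.< v × v Fin.< r × r Fin.< mate T u × mate T u Fin.< mate T v

module _ {n : ℕ} {D T : Diagram n} (s : D ↝ T) where

  -- In D the source `y` precedes a foreign sink, and only a source of T between the two can bring
  -- that about.
  crossing⇒parted : ∀ {x y} → x Fin.< y → y Fin.< mate D x → mate D x Fin.< mate D y →
                    ∃[ r ] PartedCrossing T (to s x) (to s y) r
  crossing⇒parted {x} {y} x<y y<mx mx<my =
    let x′ = ℕₚ.<-trans x<y y<mx
        y′ = ℕₚ.<-trans y<mx mx<my
        r , r′ , sy<r , r<smx = to-parted s y′ (mate-source D x′) y<mx
          (λ eq → ℕₚ.<-irrefl (cong toℕ (mate-injective D eq)) x<y)
    in r , r′ , to-sources s x′ y′ x<y , sy<r , subst (r Fin.<_) (to-mate s x) r<smx ,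
       subst₂ Fin._<_ (to-mate s x) (to-mate s y)
         (to-sinks s (mate-source D x′) (mate-source D y′) mx<my)

  noncrossing⇒unparted : Noncrossing D → ∀ {u v r} → ¬ PartedCrossing T u v r
  noncrossing⇒unparted nc {u} {v} {r} =
    subst₂ (λ u v → ¬ PartedCrossing T u v r) (to-from s u) (to-from s v) unparted
    where
    unparted : ∀ {x y} → ¬ PartedCrossing T (to s x) (to s y) r
    unparted {x} {y} (r′ , sx<sy , sy<r , r<msx , msx<msy) =
      noncrossing⇒uncrossed nc (from-sources s x′ y′ sx<sy) y<mx
        (from-sinks s mx′ (mate-source D y′)
          (subst₂ Fin._<_ (sym (to-mate s x)) (sym (to-mate s y)) msx<msy))
      where
      sy<msx = ℕₚ.<-trans sy<r r<msx
      x′     = from-source s {x} (ℕₚ.<-trans sx<sy sy<msx)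
      y′     = from-source s {y} (ℕₚ.<-trans sy<msx msx<msy)
      mx′    = mate-source D x′

      y<mx : y Fin.< mate D x
      y<mx with <⊎> (source≢sink D y′ mx′)
      ... | inj₁ y<mx = y<mx
      -- With the sink first in D, `r` could not lie between the two in T.
      ... | inj₂ mx<y = ⊥-elim (to-unparted s mx′ y′ mx<y r r′ sy<r
        (subst (r Fin.<_) (sym (to-mate s x)) r<msx))

module _ {m : ℕ} (3≤m : 3 ≤ m) where

  -- `TopCycleJoined` is functional, so a listed chord gives the matching without evaluating the
  -- search by parity.
  topCycle-mate : ∀ {i j} (i< : i < 2 * m) (j< : j < 2 * m) → TopCycleChord m (suc i) (suc j) →
                  mate (topCycle 3≤m) (Fin.fromℕ< i<) ≡ Fin.fromℕ< j<
  topCycle-mate i< j< c = Finₚ.toℕ-injective (ℕₚ.suc-injective (TopCycleJoined-functional 3≤m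
    (proj₂ (TopCycleJoined-total 3≤m (Fin.fromℕ< i<)))
    (inj₁ (subst₂ (λ i j → TopCycleChord m (suc i) (suc j))
      (sym (Finₚ.toℕ-fromℕ< i<)) (sym (Finₚ.toℕ-fromℕ< j<)) c))))

topCycle-parted : ∀ {m n} (3≤m : 3 ≤ m) {T : Diagram n} → topCycle 3≤m ⊑ T →
                  ∃[ u ] ∃[ v ] ∃[ r ] PartedCrossing T u v r
topCycle-parted {m@(suc (suc (suc k)))} {n} 3≤m@(s≤s (s≤s (s≤s _))) {T} sub =
  -- Numbered from 1, the chord (1, 4) crosses the top chord (2, 2m - 1), as m ≥ 3 gives 4 < 2m - 1.
  -- Endpoint 3 lies between 2 and 4 and is a source, with sink 6.
  e 0< , e 1< , e 2< ,
  subst (e 2< Fin.<_) (e-mate 2< 5< (path 2 (s≤s z≤n) (s≤s (s≤s z≤n)) refl refl))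
    (e-< 2< 5< (s≤s (s≤s (s≤s z≤n)))) ,
  e-< 0< 1< (s≤s z≤n) , e-< 1< 2< (s≤s (s≤s z≤n)) ,
  subst (e 2< Fin.<_) 0-3 (e-< 2< 3< (s≤s (s≤s (s≤s z≤n)))) ,
  subst₂ Fin._<_ 0-3 (e-mate 1< t< (top refl refl)) (e-< 3< t< (ℕₚ.∸-monoˡ-≤ 2 6≤2m))
  where
  open _⊑_ sub

  6≤2m : 6 ≤ 2 * m
  6≤2m = ℕₚ.*-monoʳ-≤ 2 3≤m

  0< : 0 < 2 * m
  0< = ℕₚ.≤-trans (s≤s z≤n) 6≤2m
  1< : 1 < 2 * m
  1< = ℕₚ.≤-trans (s≤s (s≤s z≤n)) 6≤2m
  2< : 2 < 2 * m
  2< = ℕₚ.≤-trans (s≤s (s≤s (s≤s z≤n))) 6≤2m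
  3< : 3 < 2 * m
  3< = ℕₚ.≤-trans (s≤s (s≤s (s≤s (s≤s z≤n)))) 6≤2m
  5< : 5 < 2 * m
  5< = 6≤2m
  t< : 2 * m ∸ 2 < 2 * m
  t< = ℕₚ.n≤1+n _

  e : ∀ {i} → i < 2 * m → Point n
  e i< = embed (Fin.fromℕ< i<)

  e-< : ∀ {i j} (i< : i < 2 * m) (j< : j < 2 * m) → i < j → e i< Fin.< e j<
  e-< i< j< i<j = embed-increasing
    (subst₂ _<_ (sym (Finₚ.toℕ-fromℕ< i<)) (sym (Finₚ.toℕ-fromℕ< j<)) i<j)

  e-mate : ∀ {i j} (i< : i < 2 * m) (j< : j < 2 * m) → TopCycleChord m (suc i) (suc j) →
           e j< ≡ mate T (e i<)
  e-mate i< j< c = trans (cong embed (sym (topCycle-mate 3≤m i< j< c))) (embed-mate _)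

  0-3 : e 3< ≡ mate T (e 0<)
  0-3 = e-mate 0< 3< (path 1 (s≤s z≤n) (s≤s z≤n) refl refl)

noncrossing⇒topCycleFree : ∀ {n} {D T : Diagram n} → D ↝ T → Noncrossing D → TopCycleFree T
noncrossing⇒topCycleFree s nc m 3≤m sub with topCycle-parted 3≤m sub
... | _ , _ , _ , crossing = noncrossing⇒unparted s nc crossing

stepwise-increasing : ∀ {N n} (f : ℕ → Fin n) → (∀ {j} → suc j < N → f j Fin.< f (suc j)) →
                      ∀ {i j} → i < j → j < N → f i Fin.< f j
stepwise-increasing f step {i} {suc j} (s≤s i≤j) 1+j<N with ℕₚ.m≤n⇒m<n∨m≡n i≤j
... | inj₁ i<j  = ℕₚ.<-trans (stepwise-increasing f step i<j (ℕₚ.<-trans (ℕₚ.n<1+n j) 1+j<N)) (step 1+j<N)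
... | inj₂ refl = step 1+j<N

-- Assembling a top cycle from a path of chords.

module _ {n : ℕ} (T : Diagram n) (v : Point n) where

  -- The part of a top cycle from its third endpoint on: v is the source of the
  -- top chord, d the source of a path chord, and b the sink of the chord before
  -- it on the path.
  data Tail (b d : Point n) : ℕ → Set where
    stop : d Fin.< b → b Fin.< mate T v → mate T v Fin.< mate T d → Tail b d 0
    step : ∀ {d′ k} → d Fin.< b → b Fin.< d′ → Tail (mate T d) d′ k → Tail b d (suc k)

  -- There are 4 + 2k endpoints from the third one on; each `step` contributes the source of its
  -- chord and the sink of the chord before.
  tail : ∀ {b d k} → Tail b d k → ℕ → Point n
  tail {b} {d} t            0             = d
  tail {b} {d} t            1             = b
  tail {b} {d} (stop _ _ _) 2             = mate T v
  -- Position 3 is the last endpoint; larger positions only receive a default value.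
  tail {b} {d} (stop _ _ _) (suc (suc (suc _))) = mate T d
  tail {b} {d} (step _ _ t) (suc (suc j)) = tail t j

  private
    2*suc : ∀ k → 2 * suc k ≡ suc (suc (2 * k))
    2*suc = ℕₚ.*-suc 2

  tail-increasing : ∀ {b d k} (t : Tail b d k) {j} → j < 3 + 2 * k → tail t j Fin.< tail t (suc j)
  tail-increasing (stop d<b _ _)   {0} _ = d<b
  tail-increasing (stop _ b<mv _)  {1} _ = b<mv
  tail-increasing (stop _ _ mv<md) {2} _ = mv<md
  tail-increasing (stop _ _ _)     {suc (suc (suc _))} (s≤s (s≤s (s≤s ())))
  tail-increasing (step d<b _ _)   {0} _ = d<b
  tail-increasing (step _ b<d′ _)  {1} _ = b<d′
  tail-increasing (step {k = k} _ _ t) {suc (suc j)} (s≤s (s≤s j<)) =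
    tail-increasing t (subst (λ l → j < 1 + l) (2*suc k) j<)

  -- The previous sink and the next source stand between the two ends of a path chord, hence the
  -- offset 3. At the end of the path the sink of `v` replaces the next source.
  tail-path : ∀ {b d k} (t : Tail b d k) i → i ≤ k → tail t (3 + 2 * i) ≡ mate T (tail t (2 * i))
  tail-path (stop _ _ _)              zero    _         = refl
  tail-path (step _ _ (stop _ _ _))   zero    _         = refl
  tail-path (step _ _ (step _ _ _))   zero    _         = refl
  tail-path (step _ _ t)              (suc i) (s≤s i≤k) rewrite 2*suc i = tail-path t i i≤k

  tail-top : ∀ {b d k} (t : Tail b d k) → tail t (2 + 2 * k) ≡ mate T v
  tail-top (stop _ _ _)         = refl
  tail-top (step {k = k} _ _ t) rewrite 2*suc k = tail-top t

  module _ {u d k} (t : Tail (mate T u) d k) (u<v : u Fin.< v) (v<d : v Fin.< d) where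

    private
      m : ℕ
      m = 3 + k

      e : ℕ → Point n
      e 0             = u
      e 1             = v
      e (suc (suc j)) = tail t j

      2m : 2 * m ≡ 6 + 2 * k
      2m = ℕₚ.*-distribˡ-+ 2 3 k

      e-step : ∀ {j} → suc j < 2 * m → e j Fin.< e (suc j)
      e-step {0} _ = u<v
      e-step {1} _ = v<d
      e-step {suc (suc j)} lt with subst (3 + j <_) 2m lt
      ... | s≤s (s≤s (s≤s lt′)) = tail-increasing t lt′

      e-mate : ∀ {i j} → TopCycleChord m (suc i) (suc j) → e j ≡ mate T (e i)
      e-mate (path (suc zero) _ _ refl refl) = tail-1 t
        where
        tail-1 : ∀ {b d k} (t : Tail b d k) → tail t 1 ≡ b
        tail-1 (stop _ _ _) = refl
        tail-1 (step _ _ _) = refl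
      -- The tail counts its chords from 0 and omits the first path chord, that of `u`; the
      -- endpoints `u` and `v` shift positions by 2.
      e-mate {i} {j} (path (suc (suc i₀)) _ (s≤s (s≤s i₀≤k)) eqᵢ eqⱼ) =
        subst₂ (λ i j → e j ≡ mate T (e i)) (sym i≡) (sym j≡) (tail-path t i₀ i₀≤k)
        where
        2i₀+4 : 2 * suc (suc i₀) ≡ 4 + 2 * i₀
        2i₀+4 = ℕₚ.*-distribˡ-+ 2 2 i₀
        i≡ : i ≡ 2 + 2 * i₀
        i≡ = ℕₚ.suc-injective (trans eqᵢ (cong (_∸ 1) 2i₀+4))
        j≡ : j ≡ 5 + 2 * i₀
        j≡ = ℕₚ.suc-injective (trans eqⱼ (trans (ℕₚ.+-comm (2 * suc (suc i₀)) 2) (cong (2 +_) 2i₀+4)))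
      e-mate {j = j} (top refl eqⱼ) = subst (λ j → e j ≡ mate T v)
        (sym (ℕₚ.suc-injective (trans eqⱼ (cong (_∸ 1) 2m)))) (tail-top t)

      joined : ∀ {i j} → TopCycleJoined m (suc i) (suc j) → e j ≡ mate T (e i)
      joined (inj₁ c) = e-mate c
      joined (inj₂ c) = sym (mate-flip T (e-mate c))

    tail⇒topCycle : ¬ TopCycleFree T
    tail⇒topCycle free = free m 3≤m record
      { embed            = e ∘ toℕ
      ; embed-increasing = λ {_} {q} p<q → stepwise-increasing e e-step p<q (Finₚ.toℕ<n q)
      ; embed-mate       = λ p → joined (proj₂ (TopCycleJoined-total 3≤m p))
      }
      where
      3≤m : 3 ≤ m
      3≤m = s≤s (s≤s (s≤s z≤n))

-- Finding the path in a one-terminal diagram.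

module _ {n : ℕ} {T : Diagram (suc n)} (one : OneTerminal T) (v : Point (suc n)) where

  private
    Highest : (b d : Point (suc n)) → Set
    Highest b d = ∀ s → IsSource T s → v Fin.< s → s Fin.< b → mate T s Fin.≤ mate T d

    climb : ∀ {b} → b Fin.< mate T v → ∃[ s ] (IsSource T s × v Fin.< s × s Fin.< b) →
            ∃[ d ] IsSource T d × v Fin.< d × d Fin.< b × Highest b d × b Fin.< mate T d
    climb {b} b<mv some
      with maximiser (toℕ ∘ mate T) (λ s → isSource? T s ×-dec v Finₚ.<? s ×-dec s Finₚ.<? b) some
    ... | d , (d′ , v<d , d<b) , max = d , d′ , v<d , d<b , highest , ℕₚ.≰⇒> high
      where
      highest : Highest b d
      highest s s′ v<s s<b = max s (s′ , v<s , s<b)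

      -- Otherwise d is terminal, hence last, hence its sink is past that of v.
      high : ¬ mate T d Fin.≤ b
      high md≤b with Finₚ.any? (λ s → isSource? T s ×-dec d Finₚ.<? s)
      ... | yes (s , s′ , d<s) =
        let r , r′ , d<r , r<md , md<mr = right-neighbor T one d′ s′ d<s
        in ℕₚ.<⇒≱ md<mr (highest r r′ (ℕₚ.<-trans v<d d<r) (ℕₚ.<-≤-trans r<md md≤b))
      ... | no none = ℕₚ.<⇒≱ (ℕₚ.≤-<-trans md≤b b<mv)
        (subst (mate T v Fin.≤_)
          (sym (last⇒mate-greatest T one d′ λ s s′ → ℕₚ.≮⇒≥ λ d<s → none (s , s′ , d<s)))
          (Finₚ.≤fromℕ (mate T v)))

    -- Well-founded recursion on the sink of `d`, which strictly increases along the path and is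
    -- bounded by the greatest endpoint.
    climb⇒Tail : ∀ {b d} → Acc Fin._>_ (mate T d) → IsSink T b → b Fin.< mate T v →
      IsSource T d → v Fin.< d → d Fin.< b → Highest b d →
      ∃ (Tail T v b d)
    climb⇒Tail {b} {d} (acc rs) b′ b<mv d′ v<d d<b highest
      with <⊎> (λ eq → ℕₚ.<-irrefl (cong toℕ (mate-injective T eq)) v<d)
    ... | inj₁ mv<md = 0 , stop d<b b<mv mv<md
    -- `d` lies between `v` and its own sink, so there is a source to choose from.
    ... | inj₂ md<mv with climb md<mv (d , d′ , v<d , d′)
    ...   | e , e′ , v<e , e<md , highest′ , md<me =
      let k , t = climb⇒Tail (rs md<me) (mate-source T d′) md<mv e′ v<e e<md highest′
      in suc k , step d<b b<e t
      where
      -- A source before `b` was a candidate when `d` was chosen, so it cannot have the higher sink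
      -- of `e`.
      b<e : b Fin.< e
      b<e with <⊎> (source≢sink T e′ b′)
      ... | inj₂ b<e = b<e
      ... | inj₁ e<b = ⊥-elim (ℕₚ.<⇒≱ md<me (highest e e′ v<e e<b))

  parted⇒topCycle : ∀ {u r} → PartedCrossing T u v r → ¬ TopCycleFree T
  parted⇒topCycle {u} {r} (r′ , u<v , v<r , r<mu , mu<mv) with climb mu<mv (r , r′ , v<r , r<mu)
  ... | d , d′ , v<d , d<mu , highest , _ =
    let u′ = ℕₚ.<-trans u<v (ℕₚ.<-trans v<r r<mu)
        _ , t = climb⇒Tail (Finᵢ.>-wellFounded _) (mate-source T u′) mu<mv d′ v<d d<mu highest
    in tail⇒topCycle T v t u<v v<d

topCycleFree⇒noncrossing : ∀ {n} {D T : Diagram (suc n)} → OneTerminal T → D ↝ T →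
                           TopCycleFree T → Noncrossing D
topCycleFree⇒noncrossing one s free = uncrossed⇒noncrossing λ x<y y<mx mx<my →
  parted⇒topCycle one _ (proj₂ (crossing⇒parted s x<y y<mx mx<my)) free

-- Compatibility with pointwise equality, and the bijection.

Before-resp : ∀ {n} {T U : Diagram n} → T ≈ᴰ U → ∀ {p q} → Before T p q → Before U p q
Before-resp {n} {T} {U} eq = λ where
    (kept f p<q)                → kept (λ p′ → T⇒U (f (U⇒T p′))) p<q
    (own p′ q≡m)                → own (T⇒U p′) (trans q≡m (eq _))
    (parted r r′ p<r r<q)       → parted r (T⇒U r′) p<r r<q
    (passed p′ q′ q<p p≢m none) → passed (subst (Fin._< _) (eq _) p′) (T⇒U q′) q<p
      (λ p≡m → p≢m (trans p≡m (sym (eq _)))) (λ r r′ → none r (U⇒T r′))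
  where
  T⇒U : ∀ {p} → IsSource T p → IsSource U p
  T⇒U {p} = subst (p Fin.<_) (eq p)

  U⇒T : ∀ {p} → IsSource U p → IsSource T p
  U⇒T {p} = subst (p Fin.<_) (sym (eq p))

module _ {n : ℕ} where

  ↝-respʳ : ∀ {D T U : Diagram n} → T ≈ᴰ U → D ↝ T → D ↝ U
  ↝-respʳ T≈U s = record
    { to            = to s
    ; to-mate       = λ p → trans (to-mate s p) (T≈U (to s p))
    ; to-before     = Before-resp T≈U ∘ to-before s
    ; to-surjective = to-surjective s
    }

  ↝-respˡ : ∀ {D E T : Diagram n} → D ≈ᴰ E → D ↝ T → E ↝ T
  ↝-respˡ D≈E s = record
    { to            = to s
    ; to-mate       = λ p → trans (cong (to s) (sym (D≈E p))) (to-mate s p)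
    ; to-before     = to-before s
    ; to-surjective = to-surjective s
    }

⁺-end : ∀ {n} (D : Diagram n) q → newSource Fin.< q → q ≡ mate (D ⁺) newSource
⁺-end D q a<q with view q
... | isOld x     = ⊥-elim (ℕₚ.<-asym a<q (old<newSource x))
... | isNewSource = ⊥-elim (ℕₚ.<-irrefl refl a<q)
... | isNewSink   = sym (mate-newSource D)

proposition8p5 : ∀ (n : ℕ) → 2 ≤ suc n →
    Σ[ f ∈ Bijection (oneTerminalTopCycleFree (suc n)) (noncrossing n) ]
    (∀ T → proj₁ (Bijection.to f T) ≈ᴰ ψ (proj₁ T))
proposition8p5 n _ = bijection , λ _ _ → refl
  where
  bijection : Bijection (oneTerminalTopCycleFree (suc n)) (noncrossing n)
  bijection = record
    { to        = λ (T , free) → ψ T ,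
        ⁺-noncrossing⁻¹ (topCycleFree⇒noncrossing (proj₂ T) (ψ-↝ T) free)
    ; cong      = λ { {T , _} {U , _} → ψ-cong T U }
    ; bijective = (λ { {T , _} {U , _} → ψ-injective T U }) , surjective
    }
    where
    -- Any diagram whose extension is a rearrangement of U must be the image of U, by `↝-unique`.
    -- Congruence and surjectivity of ψ follow from this.
    ψ-unique : ∀ {D T U} → D ⁺ ↝ T → T ≈ᴰ proj₁ U → D ≈ᴰ ψ U
    ψ-unique {D} {U = U} s T≈U =
      ⁺-injective {D = D} {E = ψ U} (↝-unique (↝-respʳ T≈U s) (ψ-↝ U))

    ψ-cong : ∀ (T U : OneTerminalDiagram (suc n)) → proj₁ T ≈ᴰ proj₁ U → ψ T ≈ᴰ ψ U
    ψ-cong T U = ψ-unique {U = U} (ψ-↝ T)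

    ψ-injective : ∀ (T U : OneTerminalDiagram (suc n)) → ψ T ≈ᴰ ψ U → proj₁ T ≈ᴰ proj₁ U
    ψ-injective T U ψT≈ψU = ↝-injective (proj₂ T) (proj₂ U)
      (↝-respˡ (⁺-cong {D = ψ T} {E = ψ U} ψT≈ψU) (ψ-↝ T)) (ψ-↝ U)

    surjective : ∀ (D : Σ[ D ∈ Diagram n ] Noncrossing D) → _
    surjective (D , nc) =
      -- The preimage arises by putting the last chord back and then undoing the rearrangement.
      let open Unmove (D ⁺)
          one = unmove-oneTerminal (newSource-source D) (⁺-end D)
          s   = unmove-↝ (newSource-source D) (⁺-end D)
      in ((unmove , one) , noncrossing⇒topCycleFree s (⁺-noncrossing nc)) ,
         λ { {T , _} T≈ → sym ∘ ψ-unique {U = T} s (sym ∘ T≈) }
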